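{- The average cost (total cost divided by $T$) of any online algorithm for dynamic bin packing is at least $\Omega\left(\sqrt{\mathrm{OPT}_{avg}\cdot\log\mu}\right)$. The bound holds even for the uniform size case and with prior knowledge of the average load and $\mu$.
   Context: Dynamic bin packing. The time horizon has length $T$, with time steps $t=1,\dots,T$. An instance is a set of intervals (VM requests) $I=[s_I,e_I)$ with size $w_I\le1$; $t\in I$ means $s_I\le t<e_I$, and then $I$ is active at $t$. The length of $I$ is $\ell_I=e_I-s_I$; without loss of generality the minimum length is $1$, and $\mu$ is the maximum length (the ratio between the maximum and minimum length). Without loss of generality, at each time at least one interval is active. A schedule assigns each interval to one machine for its entire duration (no migration); at each time the total size of active intervals on a machine is at most $1$. A machine is active at $t$ if at least one interval assigned to it is active at $t$. The total cost is the total active time summed over all machines; $\mathrm{OPT}$ is the minimum (offline) cost and $\mathrm{OPT}_{avg}=\mathrm{OPT}/T$. Uniform size case: all sizes equal $1/g$ for some integer $g$ (so a machine holds at most $g$ intervals at a time). The load at time $t$ is $v_t=\lceil\sum_{I\ni t}w_I\rceil$ and the average load is $v_{avg}=\frac1T\sum_{t=1}^Tv_t$. An online algorithm irrevocably assigns each interval to a machine upon its arrival, based only on the intervals that have arrived so far (their sizes and lengths; the length of an interval is revealed upon its arrival) and the stated prior knowledge.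
   Formalization: The average load is assumed to be at least some v₀ > 1, and the constant in Ω may depend on v₀ (not on μ or the algorithm): if the average load is known to be 1, one machine always suffices and the bound fails for large μ. -}

module Defs where

open import Data.Fin using (Fin; toℕ)
open import Data.Integer as ℤ using (ℤ; +_)
open import Data.List using (List; map; foldr; filter; take; lookup; length; allFin; applyUpTo; deduplicate)
open import Data.List.Extrema.Nat using (max)
open import Data.List.Relation.Unary.All using (All)
open import Data.List.Relation.Unary.Any using (Any)
open import Data.List.Relation.Unary.Linked using (Linked)
open import Data.Nat using (ℕ; suc; _∸_; _≤_; _<_; _≤?_; _<?_; _≟_; NonZero)
open import Data.Nat.ListAction using (sum)
open import Data.Product using (_×_; ∃-syntax)
open import Data.Rational as ℚ using (ℚ; 0ℚ; 1ℚ; _/_; ceiling)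
open import Function using (_∘_)
open import Relation.Binary.PropositionalEquality using (_≡_)
open import Relation.Nullary using (Dec; _×-dec_)

sumℚ : List ℚ → ℚ
sumℚ = foldr ℚ._+_ 0ℚ

sumℤ : List ℤ → ℤ
sumℤ = foldr ℤ._+_ (+ 0)

-- The half-open interval [start , end).
record Interval : Set where
  constructor interval
  field
    start end : ℕ
    size      : ℚ

open Interval public

duration : Interval → ℕ
duration J = end J ∸ start J

Active : ℕ → Interval → Set
Active t J = start J ≤ t × t < end J

active? : ∀ t J → Dec (Active t J)
active? t J = (start J ≤? t) ×-dec (t <? end J)

-- The list is in arrival order: requests with the same start also arrive one
-- after the other.  Time is discrete, so durations are positive integers and
-- `unit-duration` makes the minimum duration exactly 1.
record Instance : Set where
  field
    horizon       : ℕ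
    {{nonZero}}   : NonZero horizon
    intervals     : List Interval
    arrivalOrder  : Linked (λ J K → start J ≤ start K) intervals
    nonEmpty      : All (λ J → start J < end J) intervals
    inHorizon     : All (λ J → 1 ≤ start J × end J ≤ suc horizon) intervals
    sizes         : All (λ J → 0ℚ ℚ.< size J × size J ℚ.≤ 1ℚ) intervals
    neverIdle     : ∀ t → 1 ≤ t → t ≤ horizon → Any (Active t) intervals
    unit-duration : Any (λ J → duration J ≡ 1) intervals

open Instance public

times : Instance → List ℕ
times I = applyUpTo suc (horizon I)

-- Division by the horizon length.
_perStepOf_ : ℤ → Instance → ℚ
n perStepOf I = _/_ n (horizon I) {{nonZero I}}

record Uniform (I : Instance) : Set where
  field
    capacity     : ℕ
    {{positive}} : NonZero capacity
    uniform      : All (λ J → size J ≡ + 1 / capacity) (intervals I)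

maxDuration : Instance → ℕ
maxDuration I = max 0 (map duration (intervals I))

-- The number v_t.
loadAt : Instance → ℕ → ℤ
loadAt I t = ceiling (sumℚ (map size (filter (active? t) (intervals I))))

averageLoad : Instance → ℚ
averageLoad I = sumℤ (map (loadAt I) (times I)) perStepOf I

-- Machines are named by natural numbers, so their supply is unlimited.
Schedule : Instance → Set
Schedule I = Fin (length (intervals I)) → ℕ

module _ (I : Instance) (σ : Schedule I) where

  activeIndices : ℕ → List (Fin (length (intervals I)))
  activeIndices t = filter (λ i → active? t (lookup (intervals I) i)) (allFin (length (intervals I)))

  sizeOn : ℕ → ℕ → ℚ
  sizeOn m t = sumℚ (map (size ∘ lookup (intervals I)) (filter (λ i → σ i ≟ m) (activeIndices t)))

  Feasible : Set
  Feasible = ∀ m t → sizeOn m t ℚ.≤ 1ℚ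

  activeMachines : ℕ → List ℕ
  activeMachines t = deduplicate _≟_ (map σ (activeIndices t))

  -- The active time summed over all machines, counted time step by time step.
  cost : ℕ
  cost = sum (map (length ∘ activeMachines) (times I))

averageCost : (I : Instance) → Schedule I → ℚ
averageCost I σ = (+ cost I σ) perStepOf I

IsOPT : Instance → ℕ → Set
IsOPT I opt = (∃[ σ ] Feasible I σ × cost I σ ≡ opt)
            × (∀ σ → Feasible I σ → opt ≤ cost I σ)

record PriorKnowledge : Set where
  constructor knowing
  field
    average-load : ℚ
    max-duration : ℕ

knowledge : Instance → PriorKnowledge
knowledge I = knowing (averageLoad I) (maxDuration I)

-- A deterministic rule naming the machine of a newly arrived interval, given
-- the prior knowledge, the earlier arrivals (oldest first) and the new interval.
-- Its own earlier decisions are functions of these data.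
OnlineRule : Set
OnlineRule = PriorKnowledge → List Interval → Interval → ℕ

run : OnlineRule → (I : Instance) → Schedule I
run rule I i = rule (knowledge I) (take (toℕ i) (intervals I)) (lookup (intervals I) i)

-- An algorithm need only be correct on the admissible instances, and only when
-- its prior knowledge is true.  Correctness on all instances implies this for
-- every choice of `Admissible`.
record OnlineAlgorithm (Admissible : Instance → Set) : Set where
  field
    rule    : OnlineRule
    correct : ∀ I → Admissible I → Feasible I (run rule I)

  schedule : (I : Instance) → Schedule I
  schedule = run rule

open OnlineAlgorithm public using (schedule)

-- For c , x ≥ 0 this says  c · √x ≤ y.
_·√_≤_ : ℚ → ℚ → ℚ → Set
c ·√ x ≤ y = 0ℚ ℚ.≤ y × c ℚ.* c ℚ.* x ℚ.≤ y ℚ.* y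

{-# OPTIONS --safe #-}

-- Write v = p / q and let L ≈ log₂ μ.  At time t the adversary releases requests of size 1 / g that all start at t and
-- end at the end of a dyadic block around t, in increasing order of length, skipping the blocks in whose right half t
-- lies; it stops as soon as g times the number of open machines reaches the number of available blocks.  Half of the
-- blocks are available on average, so L T ≤ 2 g A for the cost A of the algorithm over the T steps.  The last request of
-- a step opens a new machine, two such requests that are active together sit on distinct machines, and lengths double,
-- so the total length released is at most T + O(A).  Offline, dyadic blocks are laminar and pack almost perfectly, with
-- cost W where g W ≤ 2 g T + 4 A.  Padding the instance with load one per step and a final step of large load makes the
-- average load exactly v; this costs O(W / v) further steps because v ≥ v₀ > 1.  The choice g² ≈ L / v balances the
-- bounds, and for L < v the bound is the trivial estimate by OPT and the load.
module Submission where

-- The prior knowledge must be true of the finished instance, yet the adversary adapts to the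
-- answers. So the rule is given v and μ beforehand, requests are grown against it, and the padding,
-- which comes last and cannot alter earlier answers, makes these values true. Requests of length
-- exactly 2ʲ from t would overlap crosswise and pack badly offline; hence the common block ends. A
-- request may then be far shorter than its block, and skipping right halves keeps its length at
-- least half the block. The stopping rule serves both sides. A step with many open machines is
-- already paid for; a step with few goes on until capacity forces more open. In both cases the last
-- request released after the unit request takes a fresh machine, and by geometric growth its block
-- length dominates those of the others of its step, so the algorithm pays for all of them. In the
-- main regime, OPT and the total load of the whole horizon are therefore both O(A / g). Since log μ
-- is about v g², the product of OPT, horizon and log μ is about g OPT times g times the total load,
-- which is O(A²).

module LowerBound where

  open import Data.Bool using (true; false; if_then_else_)
  open import Data.Empty using (⊥-elim)
  open import Data.Fin using (Fin; toℕ; zero; suc)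
  open import Data.Integer as ℤ using (ℤ) renaming (+_ to pos)
  import Data.Integer.Properties as ℤ
  open import Data.List using (List; []; _∷_; _++_; _∷ʳ_; length; map; filter; deduplicate; lookup; allFin; tabulate; take; applyUpTo; upTo; replicate; cartesianProductWith)
  open import Data.List.Extrema.Nat using (argmin; argmin-all; f[argmin]≤f[xs]; max≈v⁺)
  open import Data.List.Membership.DecPropositional using (_∈?_)
  open import Data.List.Membership.Propositional using (_∈_; _∉_; lose)
  open import Data.List.Membership.Propositional.Properties
  open import Data.List.Properties hiding (sum-++)
  open import Data.List.Relation.Binary.Subset.Propositional using (_⊆_)
  open import Data.List.Relation.Unary.All as All using (All; []; _∷_)
  import Data.List.Relation.Unary.All.Properties as All
  open import Data.List.Relation.Unary.AllPairs as AllPairs using (AllPairs; []; _∷_)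
  import Data.List.Relation.Unary.AllPairs.Properties as AllPairs
  open import Data.List.Relation.Unary.Any using (Any; here; there)
  import Data.List.Relation.Unary.Any.Properties as Any
  import Data.List.Relation.Unary.Linked.Properties as Linked
  open import Data.List.Relation.Unary.Unique.DecPropositional.Properties using (deduplicate-!)
  open import Data.List.Relation.Unary.Unique.Propositional using (Unique)
  import Data.List.Relation.Unary.Unique.Propositional.Properties as Unique
  open import Data.Nat as ℕ using (ℕ; zero; suc; pred; _+_; _*_; _∸_; _^_; _/_; _%_; ⌊_/2⌋; _≤_; _<_; _≤?_; _<?_; _≟_; NonZero; z≤n; s≤s)
  open import Data.Nat.Coprimality using (Coprime)
  open import Data.Nat.DivMod using (m≡m%n+[m/n]*n; m%n<n; m/n*n≤m; m<n*o⇒m/o<n)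
  open import Data.Nat.ListAction using (sum)
  open import Data.Nat.ListAction.Properties using (sum-++)
  open import Data.Nat.Logarithm using (⌈log₂_⌉; ⌈log₂⌉-mono-≤; ⌈log₂2^n⌉≡n)
  open import Data.Nat.Properties
  open import Data.Nat.Tactic.RingSolver using (solve-∀)
  open import Data.Product using (_×_; _,_; proj₁; proj₂; ∃-syntax)
  open import Data.Rational as ℚ using (ℚ; mkℚ; 0ℚ; 1ℚ; ceiling; toℚᵘ)
  import Data.Rational.Properties as ℚ
  open import Data.Rational.Unnormalised as ℚᵘ using (mkℚᵘ; *≡*; *≤*)
  import Data.Rational.Unnormalised.Properties as ℚᵘ
  open import Data.Sum using (_⊎_; inj₁; inj₂; [_,_]′)
  open import Defs
  open import Function using (_∘_; id)
  open import Level using (Level)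
  open import Relation.Binary using (tri<; tri≈; tri>)
  open import Relation.Binary.PropositionalEquality hiding (J)
  open import Relation.Nullary using (Dec; yes; no; ¬_; ¬?; does; _×-dec_; _⊎-dec_)
  open import Relation.Nullary.Decidable using (map′; dec-true; dec-false)
  open import Relation.Unary using (Pred; Decidable)

  -- Counting in lists and finite sums

  filter-map : ∀ {a b p} {A : Set a} {B : Set b} {P : Pred B p} (P? : Decidable P) (f : A → B) xs →
    filter P? (map f xs) ≡ map f (filter (P? ∘ f) xs)
  filter-map P? f [] = refl
  filter-map P? f (x ∷ xs) with does (P? (f x))
  ... | true = cong (f x ∷_) (filter-map P? f xs)
  ... | false = filter-map P? f xs

  ⊆-length : ∀ {a} {A : Set a} {xs ys : List A} → Unique xs → xs ⊆ ys → length xs ≤ length ys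
  ⊆-length {xs = []} _ _ = z≤n
  ⊆-length {xs = x ∷ xs} (x∉ ∷ u) sub with ∈-∃++ (sub (here refl))
  ... | as , bs , refl = begin
    suc (length xs)              ≤⟨ s≤s (⊆-length u sub′) ⟩
    suc (length (as ++ bs))      ≡⟨ cong suc (length-++ as) ⟩
    suc (length as + length bs)  ≡⟨ sym (+-suc (length as) (length bs)) ⟩
    length as + length (x ∷ bs)  ≡⟨ sym (length-++ as) ⟩
    length (as ++ x ∷ bs)        ∎
    where
    open ≤-Reasoning
    sub′ : xs ⊆ as ++ bs
    sub′ {y} y∈ with ∈-++⁻ as (sub (there y∈))
    ... | inj₁ p = ∈-++⁺ˡ p
    ... | inj₂ (here y≡x) = ⊥-elim (All.lookup x∉ y∈ (sym y≡x))
    ... | inj₂ (there p) = ∈-++⁺ʳ as p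

  distinct : List ℕ → ℕ
  distinct = length ∘ deduplicate _≟_

  unique-⊆-distinct : ∀ {xs ys} → Unique xs → xs ⊆ ys → length xs ≤ distinct ys
  unique-⊆-distinct u sub = ⊆-length u (∈-deduplicate⁺ _≟_ ∘ sub)

  distinct-≤-length : ∀ {xs ys} → xs ⊆ ys → distinct xs ≤ length ys
  distinct-≤-length {xs} sub = ⊆-length (deduplicate-! _≟_ xs) (sub ∘ ∈-deduplicate⁻ _≟_ xs)

  distinct-mono : ∀ {xs ys} → xs ⊆ ys → distinct xs ≤ distinct ys
  distinct-mono {xs} sub = unique-⊆-distinct (deduplicate-! _≟_ xs) (sub ∘ ∈-deduplicate⁻ _≟_ xs)

  distinct-map : ∀ (r : ℕ → ℕ) xs → distinct (map r xs) ≤ distinct xs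
  distinct-map r xs = begin
    distinct (map r xs)                  ≤⟨ distinct-≤-length sub ⟩
    length (map r (deduplicate _≟_ xs))  ≡⟨ length-map r (deduplicate _≟_ xs) ⟩
    distinct xs                          ∎
    where
    open ≤-Reasoning
    sub : map r xs ⊆ map r (deduplicate _≟_ xs)
    sub y∈ with ∈-map⁻ r y∈
    ... | x , x∈ , refl = ∈-map⁺ r (∈-deduplicate⁺ _≟_ x∈)

  distinct-< : ∀ {n xs} → All (_< n) xs → distinct xs ≤ n
  distinct-< {n} {xs} xs<n = begin
    distinct xs      ≤⟨ distinct-≤-length (λ x∈ → ∈-upTo⁺ (All.lookup xs<n x∈)) ⟩
    length (upTo n)  ≡⟨ length-applyUpTo _ n ⟩
    n                ∎
    where open ≤-Reasoning

  count : ℕ → List ℕ → ℕ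
  count m = length ∘ filter (_≟ m)

  filter-partition-length : ∀ {a p} {A : Set a} {P : Pred A p} (P? : Decidable P) xs →
    length xs ≡ length (filter P? xs) + length (filter (¬? ∘ P?) xs)
  filter-partition-length P? [] = refl
  filter-partition-length P? (x ∷ xs) with P? x
  ... | yes _ = cong suc (filter-partition-length P? xs)
  ... | no _ = trans (cong suc (filter-partition-length P? xs)) (sym (+-suc _ _))

  filter-⊆-length : ∀ {a p q} {A : Set a} {P : Pred A p} {Q : Pred A q} (P? : Decidable P) (Q? : Decidable Q) →
    (∀ {x} → P x → Q x) → ∀ xs → length (filter P? xs) ≤ length (filter Q? xs)
  filter-⊆-length P? Q? imp [] = z≤n
  filter-⊆-length P? Q? imp (x ∷ xs) with P? x | Q? x
  ... | yes _ | yes _ = s≤s (filter-⊆-length P? Q? imp xs)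
  ... | yes p | no ¬q = ⊥-elim (¬q (imp p))
  ... | no _  | yes _ = m≤n⇒m≤1+n (filter-⊆-length P? Q? imp xs)
  ... | no _  | no _  = filter-⊆-length P? Q? imp xs

  filter-filter-length : ∀ {a p q} {A : Set a} {P : Pred A p} {Q : Pred A q} (P? : Decidable P) (Q? : Decidable Q) →
    ∀ xs → length (filter Q? (filter P? xs)) ≤ length (filter Q? xs)
  filter-filter-length P? Q? [] = z≤n
  filter-filter-length P? Q? (x ∷ xs) with P? x
  ... | yes _ with Q? x
  ...   | yes _ = s≤s (filter-filter-length P? Q? xs)
  ...   | no _  = filter-filter-length P? Q? xs
  filter-filter-length P? Q? (x ∷ xs) | no _ with Q? x
  ...   | yes _ = m≤n⇒m≤1+n (filter-filter-length P? Q? xs)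
  ...   | no _  = filter-filter-length P? Q? xs

  cover-length : ∀ {g} ns ms → ms ⊆ ns → (∀ m → count m ms ≤ g) → length ms ≤ length ns * g
  cover-length [] [] sub bound = z≤n
  cover-length [] (m ∷ ms) sub bound with sub (here refl)
  ... | ()
  cover-length {g} (n ∷ ns) ms sub bound = begin
    length ms                                   ≡⟨ filter-partition-length (_≟ n) ms ⟩
    count n ms + length (filter (¬? ∘ (_≟ n)) ms)
      ≤⟨ +-mono-≤ (bound n) (cover-length ns _ sub′ (λ m → ≤-trans (filter-filter-length _ (_≟ m) ms) (bound m))) ⟩
    g + length ns * g                           ∎
    where
    open ≤-Reasoning
    sub′ : filter (¬? ∘ (_≟ n)) ms ⊆ ns
    sub′ x∈ with ∈-filter⁻ (¬? ∘ (_≟ n)) x∈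
    ... | x∈ms , x≢n with sub x∈ms
    ...   | here x≡n = ⊥-elim (x≢n x≡n)
    ...   | there p = p

  -- Capacity as a lower bound on machines: each name absorbs at most `g` entries, so many active
  -- requests force many open machines.
  length-≤-distinct : ∀ {g} ms → (∀ m → count m ms ≤ g) → length ms ≤ g * distinct ms
  length-≤-distinct {g} ms bound = begin
    length ms        ≤⟨ cover-length (deduplicate _≟_ ms) ms (∈-deduplicate⁺ _≟_) bound ⟩
    distinct ms * g  ≡⟨ *-comm (distinct ms) g ⟩
    g * distinct ms  ∎
    where open ≤-Reasoning

  quotient-class-length : ∀ g .{{_ : NonZero g}} m xs → Unique xs → All (λ x → x / g ≡ m) xs → length xs ≤ g
  quotient-class-length g m xs u all = begin
    length xs                        ≤⟨ ⊆-length u sub ⟩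
    length (applyUpTo (_+ m * g) g)  ≡⟨ length-applyUpTo _ g ⟩
    g                                ∎
    where
    open ≤-Reasoning
    sub : xs ⊆ applyUpTo (_+ m * g) g
    sub {x} x∈ = subst (_∈ applyUpTo (_+ m * g) g)
      (sym (trans (m≡m%n+[m/n]*n x g) (cong (λ k → x % g + k * g) (All.lookup all x∈))))
      (∈-applyUpTo⁺ (_+ m * g) (m%n<n x g))

  -- Dividing distinct positions by `g` is how the dyadic requests and the final stack are spread
  -- over machines: a quotient is shared by at most `g` numbers, one for each remainder.
  count-quotients : ∀ g .{{_ : NonZero g}} m xs → Unique xs → count m (map (_/ g) xs) ≤ g
  count-quotients g m xs u = begin
    count m (map (_/ g) xs)                            ≡⟨ cong length (filter-map (_≟ m) (_/ g) xs) ⟩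
    length (map (_/ g) (filter (λ x → x / g ≟ m) xs))  ≡⟨ length-map (_/ g) (filter (λ x → x / g ≟ m) xs) ⟩
    length (filter (λ x → x / g ≟ m) xs)               ≤⟨ quotient-class-length g m _ (Unique.filter⁺ _ u) (All.all-filter _ xs) ⟩
    g                                                  ∎
    where open ≤-Reasoning

  Σ< : ℕ → (ℕ → ℕ) → ℕ
  Σ< zero f = 0
  Σ< (suc n) f = Σ< n f + f n

  Σ<-mono : ∀ n {f h : ℕ → ℕ} → (∀ i → i < n → f i ≤ h i) → Σ< n f ≤ Σ< n h
  Σ<-mono zero f≤h = z≤n
  Σ<-mono (suc n) f≤h = +-mono-≤ (Σ<-mono n (λ i i<n → f≤h i (m≤n⇒m≤1+n i<n))) (f≤h n ≤-refl)

  Σ<-cong : ∀ n {f h : ℕ → ℕ} → (∀ i → i < n → f i ≡ h i) → Σ< n f ≡ Σ< n h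
  Σ<-cong zero f≡h = refl
  Σ<-cong (suc n) f≡h = cong₂ _+_ (Σ<-cong n (λ i i<n → f≡h i (m≤n⇒m≤1+n i<n))) (f≡h n ≤-refl)

  Σ<-+ : ∀ n (f h : ℕ → ℕ) → Σ< n (λ i → f i + h i) ≡ Σ< n f + Σ< n h
  Σ<-+ zero f h = refl
  Σ<-+ (suc n) f h = begin
    Σ< n (λ i → f i + h i) + (f n + h n)  ≡⟨ cong (_+ (f n + h n)) (Σ<-+ n f h) ⟩
    (Σ< n f + Σ< n h) + (f n + h n)       ≡⟨ +-assoc (Σ< n f) _ _ ⟩
    Σ< n f + (Σ< n h + (f n + h n))       ≡⟨ cong (Σ< n f +_) (x+[y+z]≡y+[x+z] (Σ< n h) (f n) (h n)) ⟩
    Σ< n f + (f n + (Σ< n h + h n))       ≡⟨ sym (+-assoc (Σ< n f) _ _) ⟩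
    (Σ< n f + f n) + (Σ< n h + h n)       ∎
    where
    open ≡-Reasoning
    x+[y+z]≡y+[x+z] : ∀ x y z → x + (y + z) ≡ y + (x + z)
    x+[y+z]≡y+[x+z] x y z = trans (sym (+-assoc x y z)) (trans (cong (_+ z) (+-comm x y)) (+-assoc y x z))

  Σ<-*ˡ : ∀ n c (f : ℕ → ℕ) → Σ< n (λ i → c * f i) ≡ c * Σ< n f
  Σ<-*ˡ zero c f = sym (*-zeroʳ c)
  Σ<-*ˡ (suc n) c f = trans (cong (_+ c * f n) (Σ<-*ˡ n c f)) (sym (*-distribˡ-+ c _ (f n)))

  Σ<-const : ∀ n c → Σ< n (λ _ → c) ≡ n * c
  Σ<-const zero c = refl
  Σ<-const (suc n) c = trans (cong (_+ c) (Σ<-const n c)) (+-comm (n * c) c)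

  Σ<-split : ∀ m n (f : ℕ → ℕ) → Σ< (m + n) f ≡ Σ< m f + Σ< n (λ i → f (m + i))
  Σ<-split m zero f = trans (cong (λ k → Σ< k f) (+-identityʳ m)) (sym (+-identityʳ _))
  Σ<-split m (suc n) f = begin
    Σ< (m + suc n) f                              ≡⟨ cong (λ k → Σ< k f) (+-suc m n) ⟩
    Σ< (m + n) f + f (m + n)                      ≡⟨ cong (_+ f (m + n)) (Σ<-split m n f) ⟩
    Σ< m f + Σ< n (λ i → f (m + i)) + f (m + n)   ≡⟨ +-assoc (Σ< m f) _ _ ⟩
    Σ< m f + Σ< (suc n) (λ i → f (m + i))         ∎
    where open ≡-Reasoning

  sum-applyUpTo : ∀ (f : ℕ → ℕ) n → sum (applyUpTo f n) ≡ Σ< n f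
  sum-applyUpTo f zero = refl
  sum-applyUpTo f (suc n) = begin
    f 0 + sum (applyUpTo (f ∘ suc) n)  ≡⟨ cong (f 0 +_) (sum-applyUpTo (f ∘ suc) n) ⟩
    f 0 + Σ< n (f ∘ suc)               ≡⟨ sym (Σ<-split 1 n f) ⟩
    Σ< (suc n) f                       ∎
    where open ≡-Reasoning

  -- Rounding up and fractions

  ⌈_/⌉ : ℕ → (g : ℕ) .{{_ : NonZero g}} → ℕ
  ⌈ n /⌉ g = (n + pred g) / g

  -- The rounded quotient is pinned down by two inequalities without division. These survive
  -- cross-multiplication, so a ceiling computed from a fraction in lowest terms can be compared
  -- with one computed from the original numerator and denominator.
  IsCeil : ℕ → ℕ → ℕ → Set
  IsCeil c n g = n ≤ c * g × c * g < n + g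

  IsCeil-unique : ∀ {c c′ n g} → IsCeil c n g → IsCeil c′ n g → c ≡ c′
  IsCeil-unique {c} {c′} {n} {g} (l , u) (l′ , u′) = ≤-antisym (le {c} {c′} u l′) (le {c′} {c} u′ l)
    where
    le : ∀ {a b} → a * g < n + g → n ≤ b * g → a ≤ b
    le {a} {b} p q = ≤-pred (*-cancelʳ-< g a (suc b)
      (≤-trans p (≤-trans (+-monoˡ-≤ g q) (≤-reflexive (+-comm (b * g) g)))))

  ⌈/⌉-isCeil : ∀ n g .{{_ : NonZero g}} → IsCeil (⌈ n /⌉ g) n g
  ⌈/⌉-isCeil n g@(suc h) = +-cancelʳ-≤ h n _ lo , s≤s-hi
    where
    open ≤-Reasoning
    c = (n + h) / g
    lo : n + h ≤ c * g + h
    lo = begin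
      n + h                    ≡⟨ m≡m%n+[m/n]*n (n + h) g ⟩
      (n + h) % g + c * g      ≤⟨ +-monoˡ-≤ (c * g) (≤-pred (m%n<n (n + h) g)) ⟩
      h + c * g                ≡⟨ +-comm h (c * g) ⟩
      c * g + h                ∎
    s≤s-hi : c * g < n + g
    s≤s-hi = begin-strict
      c * g                    ≤⟨ m≤n+m (c * g) ((n + h) % g) ⟩
      (n + h) % g + c * g      ≡⟨ sym (m≡m%n+[m/n]*n (n + h) g) ⟩
      n + h                    <⟨ +-monoʳ-< n (n<1+n h) ⟩
      n + g                    ∎

  ⌈/⌉-≤ : ∀ {n b} g .{{_ : NonZero g}} → n ≤ g * b → ⌈ n /⌉ g ≤ b
  ⌈/⌉-≤ {n} {b} g n≤ with ⌈/⌉-isCeil n g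
  ... | _ , u = ≤-pred (*-cancelʳ-< g _ (suc b) (≤-trans u
    (≤-trans (+-monoˡ-≤ g n≤) (≤-reflexive (trans (cong (_+ g) (*-comm g b)) (+-comm (b * g) g))))))

  ⌈/⌉-mono : ∀ {n n′} g .{{_ : NonZero g}} → n ≤ n′ → ⌈ n /⌉ g ≤ ⌈ n′ /⌉ g
  ⌈/⌉-mono {n} {n′} g n≤ = ⌈/⌉-≤ g (≤-trans n≤ (≤-trans (Data.Product.proj₁ (⌈/⌉-isCeil n′ g)) (≤-reflexive (*-comm _ g))))

  ⌈/⌉-exact : ∀ n g .{{_ : NonZero g}} → ⌈ g * n /⌉ g ≡ n
  ⌈/⌉-exact n g = IsCeil-unique {n = g * n} {g = g} (⌈/⌉-isCeil (g * n) g)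
    (≤-reflexive (*-comm g n) , subst (_< g * n + g) (*-comm g n) (m<m+n (g * n) (ℕ.>-nonZero⁻¹ g)))

  ⌈/⌉-* : ∀ n g .{{_ : NonZero g}} → g * ⌈ n /⌉ g ≤ n + g
  ⌈/⌉-* n g with ⌈/⌉-isCeil n g
  ... | _ , u = ≤-trans (≤-reflexive (*-comm g _)) (<⇒≤ u)

  ⌈1/⌉ : ∀ g .{{_ : NonZero g}} → ⌈ 1 /⌉ g ≡ 1
  ⌈1/⌉ g = IsCeil-unique {n = 1} {g = g} (⌈/⌉-isCeil 1 g)
    (≤-trans (ℕ.>-nonZero⁻¹ g) (≤-reflexive (sym (*-identityˡ g))) , s≤s (≤-reflexive (*-identityˡ g)))

  -- `ceiling` is minus the floor of the negated fraction, and floor division of a negative integer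
  -- separates a zero remainder from a positive one; the clauses follow that split.
  ceiling-mkℚ : ∀ a b .(c : Coprime a (suc b)) → ceiling (mkℚ (pos a) b c) ≡ pos (⌈ a /⌉ (suc b))
  ceiling-mkℚ zero b c = sym (cong pos (IsCeil-unique {n = 0} {g = suc b} (⌈/⌉-isCeil 0 (suc b)) (z≤n , s≤s z≤n)))
  ceiling-mkℚ a@(suc k) b c with a % suc b in eq
  ... | zero = trans (cong ℤ.-_ (ℤ.*-identityˡ _)) (trans (ℤ.neg-involutive _)
    (cong pos (IsCeil-unique {n = a} {g = suc b} (≤-reflexive a≡ , subst (_< a + suc b) a≡ (m<m+n a (s≤s z≤n))) (⌈/⌉-isCeil a (suc b)))))
    where
    a≡ : a ≡ a / suc b * suc b
    a≡ = trans (m≡m%n+[m/n]*n a (suc b)) (cong (_+ a / suc b * suc b) eq)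
  ... | suc r = trans (cong ℤ.-_ (ℤ.*-identityˡ ℤ.-[1+ a / suc b ]))
    (cong pos (IsCeil-unique {n = a} {g = suc b} (lo , hi) (⌈/⌉-isCeil a (suc b))))
    where
    g = suc b
    c′ = a / g
    a≡ : a ≡ suc r + c′ * g
    a≡ = trans (m≡m%n+[m/n]*n a g) (cong (_+ c′ * g) eq)
    lo : a ≤ suc c′ * g
    lo = ≤-trans (≤-reflexive a≡) (+-monoˡ-≤ (c′ * g) (<⇒≤ (subst (_< g) eq (m%n<n a g))))
    hi : suc c′ * g < a + g
    hi = ≤-trans (+-monoʳ-< g (subst (c′ * g <_) (sym a≡) (s≤s (m≤n+m (c′ * g) r)))) (≤-reflexive (+-comm g a))

  IsCeil-cross : ∀ {c a b n g} .{{_ : NonZero b}} .{{_ : NonZero g}} → a * g ≡ n * b → IsCeil c a b → IsCeil c n g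
  IsCeil-cross {c} {a} {b} {n} {g} eq (l , u) =
    *-cancelʳ-≤ n (c * g) b (≤-trans (≤-reflexive (sym eq)) (≤-trans (*-monoˡ-≤ g l) (≤-reflexive (swap c b g)))) ,
    *-cancelʳ-< b (c * g) (n + g) (≤-trans (s≤s (≤-reflexive (swap c g b)))
      (≤-trans (*-monoˡ-< g u) (≤-reflexive
        (trans (*-distribʳ-+ g a b) (trans (cong₂ _+_ eq (*-comm b g)) (sym (*-distribʳ-+ b n g)))))))
    where
    swap : ∀ x y z → x * y * z ≡ x * z * y
    swap = solve-∀

  infix 8 _/ₙ_
  _/ₙ_ : ℕ → (g : ℕ) .{{_ : NonZero g}} → ℚ
  n /ₙ g = pos n ℚ./ g

  toℚᵘ-/ₙ : ∀ n g → toℚᵘ (n /ₙ suc g) ℚᵘ.≃ mkℚᵘ (pos n) g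
  toℚᵘ-/ₙ n g = ℚ.toℚᵘ-fromℚᵘ (mkℚᵘ (pos n) g)

  ceiling-/ₙ : ∀ n g .{{_ : NonZero g}} → ceiling (n /ₙ g) ≡ pos (⌈ n /⌉ g)
  ceiling-/ₙ n g@(suc h) with n /ₙ g | toℚᵘ-/ₙ n h
  ... | mkℚ (pos a) b c | *≡* eq = trans (ceiling-mkℚ a b c)
    (cong pos (IsCeil-unique {n = n} {g = g}
      (IsCeil-cross {c = ⌈ a /⌉ (suc b)} {b = suc b} (ℤ.+-injective (trans (ℤ.pos-* a g) (trans eq (sym (ℤ.pos-* n (suc b)))))) (⌈/⌉-isCeil a (suc b)))
      (⌈/⌉-isCeil n g)))
  ... | mkℚ (ℤ.-[1+ a ]) b c | *≡* eq with trans eq (sym (ℤ.pos-* n (suc b)))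
  ...   | ()

  /ₙ-≤ : ∀ {a b c d} .{{_ : NonZero b}} .{{_ : NonZero d}} → a * d ≤ c * b → a /ₙ b ℚ.≤ c /ₙ d
  /ₙ-≤ {a} {suc b} {c} {suc d} le = ℚ.toℚᵘ-cancel-≤ (ℚᵘ.≤-respʳ-≃ (ℚᵘ.≃-sym (toℚᵘ-/ₙ c d)) (ℚᵘ.≤-respˡ-≃ (ℚᵘ.≃-sym (toℚᵘ-/ₙ a b))
    (*≤* (subst₂ ℤ._≤_ (ℤ.pos-* a (suc d)) (ℤ.pos-* c (suc b)) (ℤ.+≤+ le)))))

  /ₙ-≤⁻¹ : ∀ {a b c d} .{{_ : NonZero b}} .{{_ : NonZero d}} → a /ₙ b ℚ.≤ c /ₙ d → a * d ≤ c * b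
  /ₙ-≤⁻¹ {a} {suc b} {c} {suc d} le with ℚᵘ.≤-respʳ-≃ (toℚᵘ-/ₙ c d) (ℚᵘ.≤-respˡ-≃ (toℚᵘ-/ₙ a b) (ℚ.toℚᵘ-mono-≤ le))
  ... | *≤* le′ = ℤ.drop‿+≤+ (subst₂ ℤ._≤_ (sym (ℤ.pos-* a (suc d))) (sym (ℤ.pos-* c (suc b))) le′)

  /ₙ-≡ : ∀ {a b c d} .{{_ : NonZero b}} .{{_ : NonZero d}} → a * d ≡ c * b → a /ₙ b ≡ c /ₙ d
  /ₙ-≡ {a} {b} {c} {d} eq = ℚ.≤-antisym (/ₙ-≤ {a} {b} {c} {d} (≤-reflexive eq)) (/ₙ-≤ {c} {d} {a} {b} (≤-reflexive (sym eq)))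

  /ₙ-* : ∀ a b c d .{{_ : NonZero b}} .{{_ : NonZero d}} .{{bd≢0 : NonZero (b * d)}} → a /ₙ b ℚ.* c /ₙ d ≡ (a * c) /ₙ (b * d)
  /ₙ-* a (suc b) c (suc d) = ℚ.toℚᵘ-injective (ℚᵘ.≃-trans (ℚ.toℚᵘ-homo-* (a /ₙ suc b) (c /ₙ suc d))
    (ℚᵘ.≃-trans (ℚᵘ.*-cong (toℚᵘ-/ₙ a b) (toℚᵘ-/ₙ c d))
    (ℚᵘ.≃-trans (*≡* (cong (ℤ._* (pos (suc b * suc d))) (sym (ℤ.pos-* a c)))) (ℚᵘ.≃-sym (toℚᵘ-/ₙ (a * c) (d + b * suc d))))))

  /ₙ-+ : ∀ a c g .{{_ : NonZero g}} → a /ₙ g ℚ.+ c /ₙ g ≡ (a + c) /ₙ g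
  /ₙ-+ a c (suc g) = ℚ.toℚᵘ-injective (ℚᵘ.≃-trans (ℚ.toℚᵘ-homo-+ (a /ₙ suc g) (c /ₙ suc g))
    (ℚᵘ.≃-trans (ℚᵘ.+-cong (toℚᵘ-/ₙ a g) (toℚᵘ-/ₙ c g))
    (ℚᵘ.≃-trans (*≡* (trans (cong (ℤ._* pos (suc g)) (sym (ℤ.*-distribʳ-+ (pos (suc g)) (pos a) (pos c))))
       (trans (ℤ.*-assoc (pos a ℤ.+ pos c) (pos (suc g)) (pos (suc g))) (cong ((pos a ℤ.+ pos c) ℤ.*_) (sym (ℤ.pos-* (suc g) (suc g)))))))
    (ℚᵘ.≃-sym (toℚᵘ-/ₙ (a + c) g)))))

  0/ₙ : ∀ g .{{_ : NonZero g}} → 0 /ₙ g ≡ 0ℚ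
  0/ₙ g = /ₙ-≡ {0} {g} {0} {1} refl

  sumℚ-uniform : ∀ g .{{_ : NonZero g}} xs → All (_≡ 1 /ₙ g) xs → sumℚ xs ≡ length xs /ₙ g
  sumℚ-uniform g [] [] = sym (0/ₙ g)
  sumℚ-uniform g (x ∷ xs) (refl ∷ all) = trans (cong (1 /ₙ g ℚ.+_) (sumℚ-uniform g xs all)) (/ₙ-+ 1 (length xs) g)

  -- Schedules as lists of placed requests

  -- A `Schedule` is a function on the positions of one fixed instance. Pairs of request and machine
  -- turn prefixes and concatenations of schedules into list operations, which suits both the
  -- adaptive play and the padding.
  Placed : Set
  Placed = Interval × ℕ

  on : ℕ → List Placed → List ℕ
  on t pl = map proj₂ (filter (active? t ∘ proj₁) pl)

  bins : ℕ → List Placed → ℕ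
  bins t = distinct ∘ on t

  Fits : ℕ → List Placed → Set
  Fits g pl = ∀ m t → count m (on t pl) ≤ g

  on-++ : ∀ t xs ys → on t (xs ++ ys) ≡ on t xs ++ on t ys
  on-++ t xs ys = trans (cong (map proj₂) (filter-++ (active? t ∘ proj₁) xs ys)) (map-++ proj₂ (filter (active? t ∘ proj₁) xs) _)

  on-⊆-++ : ∀ t xs ys → on t xs ⊆ on t (xs ++ ys)
  on-⊆-++ t xs ys x∈ = subst (_ ∈_) (sym (on-++ t xs ys)) (∈-++⁺ˡ x∈)

  bins-mono-++ : ∀ t xs ys → bins t xs ≤ bins t (xs ++ ys)
  bins-mono-++ t xs ys = distinct-mono (on-⊆-++ t xs ys)

  -- Later requests only add to the count on a machine. Correctness is applied to the finished
  -- instance, and this passes it down to every stage of the play.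
  Fits-++ˡ : ∀ {g} xs ys → Fits g (xs ++ ys) → Fits g xs
  Fits-++ˡ {g} xs ys fits m t = begin
    count m (on t xs)                      ≤⟨ m≤m+n _ _ ⟩
    count m (on t xs) + count m (on t ys)  ≡⟨ sym (length-++ (filter (_≟ m) (on t xs))) ⟩
    length (filter (_≟ m) (on t xs) ++ filter (_≟ m) (on t ys))
      ≡⟨ cong length (sym (filter-++ (_≟ m) (on t xs) (on t ys))) ⟩
    count m (on t xs ++ on t ys)           ≡⟨ cong (count m) (sym (on-++ t xs ys)) ⟩
    count m (on t (xs ++ ys))              ≤⟨ fits m t ⟩
    _                                      ∎
    where open ≤-Reasoning

  length-on : ∀ t pl → length (on t pl) ≡ length (filter (active? t) (map proj₁ pl))
  length-on t pl = begin
    length (on t pl)                                           ≡⟨ length-map proj₂ (filter (active? t ∘ proj₁) pl) ⟩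
    length (filter (active? t ∘ proj₁) pl)                     ≡⟨ sym (length-map proj₁ (filter (active? t ∘ proj₁) pl)) ⟩
    length (map proj₁ (filter (active? t ∘ proj₁) pl))         ≡⟨ cong length (sym (filter-map (active? t) proj₁ pl)) ⟩
    length (filter (active? t) (map proj₁ pl))                 ∎
    where open ≡-Reasoning

  module _ (I : Instance) (σ : Schedule I) where

    placed : List Placed
    placed = map (λ i → lookup (intervals I) i , σ i) (allFin (length (intervals I)))

    map-σ-active : ∀ t → map σ (activeIndices I σ t) ≡ on t placed
    map-σ-active t = begin
      map σ (activeIndices I σ t)                ≡⟨ map-∘ {g = proj₂} {f = f} (activeIndices I σ t) ⟩
      map proj₂ (map f (activeIndices I σ t))    ≡⟨ cong (map proj₂) (sym (filter-map (active? t ∘ proj₁) f (allFin (length (intervals I))))) ⟩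
      on t placed                                ∎
      where
      open ≡-Reasoning
      f : Fin (length (intervals I)) → Placed
      f i = lookup (intervals I) i , σ i

    cost-placed : cost I σ ≡ Σ< (horizon I) (λ t → bins (suc t) placed)
    cost-placed = begin
      sum (map (length ∘ activeMachines I σ) (applyUpTo suc (horizon I)))
        ≡⟨ cong sum (map-cong (λ t → cong distinct (map-σ-active t)) (times I)) ⟩
      sum (map (λ t → bins t placed) (applyUpTo suc (horizon I)))
        ≡⟨ cong sum (map-applyUpTo suc (λ t → bins t placed) (horizon I)) ⟩
      sum (applyUpTo (λ t → bins (suc t) placed) (horizon I))
        ≡⟨ sum-applyUpTo (λ t → bins (suc t) placed) (horizon I) ⟩
      Σ< (horizon I) (λ t → bins (suc t) placed) ∎
      where open ≡-Reasoning

    module _ (g : ℕ) .{{_ : NonZero g}} (sizes≡ : All (λ J → size J ≡ 1 /ₙ g) (intervals I)) where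

      sizeOn-placed : ∀ m t → sizeOn I σ m t ≡ count m (on t placed) /ₙ g
      sizeOn-placed m t = begin
        sumℚ (map (size ∘ lookup (intervals I)) is)  ≡⟨ sumℚ-uniform g _ (All.map⁺ (All.universal (λ i → All.lookup sizes≡ (∈-lookup i)) is)) ⟩
        length (map (size ∘ lookup (intervals I)) is) /ₙ g  ≡⟨ cong (_/ₙ g) eq ⟩
        count m (on t placed) /ₙ g                   ∎
        where
        open ≡-Reasoning
        is = filter (λ i → σ i ≟ m) (activeIndices I σ t)
        eq : length (map (size ∘ lookup (intervals I)) is) ≡ count m (on t placed)
        eq = begin
          length (map (size ∘ lookup (intervals I)) is)        ≡⟨ length-map _ is ⟩
          length is                                            ≡⟨ sym (length-map σ is) ⟩
          length (map σ is)                                    ≡⟨ cong length (sym (filter-map (_≟ m) σ (activeIndices I σ t))) ⟩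
          count m (map σ (activeIndices I σ t))                ≡⟨ cong (count m) (map-σ-active t) ⟩
          count m (on t placed)                                ∎

      Feasible⇒Fits : Feasible I σ → Fits g placed
      Feasible⇒Fits feas m t = subst₂ _≤_ (*-identityʳ _) (*-identityˡ g)
        (/ₙ-≤⁻¹ {count m (on t placed)} {g} {1} {1} (subst (ℚ._≤ 1ℚ) (sizeOn-placed m t) (feas m t)))

      Fits⇒Feasible : Fits g placed → Feasible I σ
      Fits⇒Feasible fits m t = subst (ℚ._≤ 1ℚ) (sym (sizeOn-placed m t))
        (/ₙ-≤ {count m (on t placed)} {g} {1} {1} (subst₂ _≤_ (sym (*-identityʳ _)) (sym (*-identityˡ g)) (fits m t)))

  numActive : ℕ → List Interval → ℕ
  numActive t = length ∘ filter (active? t)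

  loadAt-uniform : ∀ I g .{{_ : NonZero g}} → All (λ J → size J ≡ 1 /ₙ g) (intervals I) →
    ∀ t → loadAt I t ≡ pos (⌈ numActive t (intervals I) /⌉ g)
  loadAt-uniform I g sizes≡ t = begin
    ℚ.ceiling (sumℚ (map size Js))        ≡⟨ cong ℚ.ceiling (sumℚ-uniform g (map size Js) (All.map⁺ (All.filter⁺ (active? t) sizes≡))) ⟩
    ℚ.ceiling (length (map size Js) /ₙ g) ≡⟨ ceiling-/ₙ (length (map size Js)) g ⟩
    pos (⌈ length (map size Js) /⌉ g)     ≡⟨ cong (λ n → pos (⌈ n /⌉ g)) (length-map size Js) ⟩
    pos (⌈ numActive t (intervals I) /⌉ g) ∎
    where
    open ≡-Reasoning
    Js = filter (active? t) (intervals I)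

  sumℤ-+ : ∀ ns → sumℤ (map pos ns) ≡ pos (sum ns)
  sumℤ-+ [] = refl
  sumℤ-+ (n ∷ ns) = cong (λ z → pos n ℤ.+ z) (sumℤ-+ ns)

  averageLoad-uniform : ∀ I g .{{_ : NonZero g}} → All (λ J → size J ≡ 1 /ₙ g) (intervals I) →
    averageLoad I ≡ (pos (Σ< (horizon I) (λ t → ⌈ numActive (suc t) (intervals I) /⌉ g))) perStepOf I
  averageLoad-uniform I g sizes≡ = cong (λ z → z perStepOf I) (begin
    sumℤ (map (loadAt I) (times I))                  ≡⟨ cong sumℤ (map-cong (loadAt-uniform I g sizes≡) (times I)) ⟩
    sumℤ (map (pos ∘ load) (applyUpTo suc (horizon I))) ≡⟨ cong sumℤ (map-∘ (times I)) ⟩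
    sumℤ (map pos (map load (times I)))               ≡⟨ sumℤ-+ (map load (times I)) ⟩
    pos (sum (map load (applyUpTo suc (horizon I)))) ≡⟨ cong (pos ∘ sum) (map-applyUpTo suc load (horizon I)) ⟩
    pos (sum (applyUpTo (load ∘ suc) (horizon I)))   ≡⟨ cong pos (sum-applyUpTo (load ∘ suc) (horizon I)) ⟩
    pos (Σ< (horizon I) (load ∘ suc))                ∎)
    where
    open ≡-Reasoning
    load : ℕ → ℕ
    load t = ⌈ numActive t (intervals I) /⌉ g

  -- Online rules played along a list of requests

  play : (List Interval → Interval → ℕ) → List Interval → List Interval → List Placed
  play ρ past [] = []
  play ρ past (J ∷ Js) = (J , ρ past J) ∷ play ρ (past ∷ʳ J) Js

  -- The decisions on `Js` do not see `Ks`. This is the online property; it lets the adversary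
  -- extend the list after watching the answers.
  play-++ : ∀ ρ past Js Ks → play ρ past (Js ++ Ks) ≡ play ρ past Js ++ play ρ (past ++ Js) Ks
  play-++ ρ past [] Ks = cong (λ p → play ρ p Ks) (sym (++-identityʳ past))
  play-++ ρ past (J ∷ Js) Ks = cong (_ ∷_) (trans (play-++ ρ (past ∷ʳ J) Js Ks)
    (cong (λ p → play ρ (past ∷ʳ J) Js ++ play ρ p Ks) (++-assoc past (J ∷ []) Js)))

  map-proj₁-play : ∀ ρ past Js → map proj₁ (play ρ past Js) ≡ Js
  map-proj₁-play ρ past [] = refl
  map-proj₁-play ρ past (J ∷ Js) = cong (J ∷_) (map-proj₁-play ρ (past ∷ʳ J) Js)

  play-tabulate : ∀ ρ past Js →
    tabulate (λ i → lookup Js i , ρ (past ++ take (toℕ i) Js) (lookup Js i)) ≡ play ρ past Js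
  play-tabulate ρ past [] = refl
  play-tabulate ρ past (J ∷ Js) = cong₂ _∷_ (cong (λ p → J , ρ p J) (++-identityʳ past))
    (trans (tabulate-cong (λ i → cong (λ p → lookup Js i , ρ p (lookup Js i)) (sym (++-assoc past (J ∷ []) (take (toℕ i) Js)))))
           (play-tabulate ρ (past ∷ʳ J) Js))

  placed-run : ∀ rule I → placed I (run rule I) ≡ play (rule (knowledge I)) [] (intervals I)
  placed-run rule I = trans (map-tabulate id _) (play-tabulate (rule (knowledge I)) [] (intervals I))

  -- Existence of OPT

  nth : List ℕ → ℕ → ℕ
  nth [] _ = 0
  nth (x ∷ xs) zero = x
  nth (x ∷ xs) (suc k) = nth xs k

  indexOf : List ℕ → ℕ → ℕ
  indexOf [] x = 0
  indexOf (y ∷ ys) x with x ≟ y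
  ... | yes _ = 0
  ... | no _ = suc (indexOf ys x)

  nth-indexOf : ∀ {x} ys → x ∈ ys → nth ys (indexOf ys x) ≡ x
  nth-indexOf {x} (y ∷ ys) x∈ with x ≟ y
  nth-indexOf (y ∷ ys) x∈ | yes x≡y = sym x≡y
  nth-indexOf (y ∷ ys) (here x≡y) | no x≢y = ⊥-elim (x≢y x≡y)
  nth-indexOf (y ∷ ys) (there x∈) | no _ = nth-indexOf ys x∈

  indexOf-< : ∀ {x} ys → x ∈ ys → indexOf ys x < length ys
  indexOf-< {x} (y ∷ ys) x∈ with x ≟ y
  indexOf-< (y ∷ ys) x∈ | yes _ = s≤s z≤n
  indexOf-< (y ∷ ys) (here x≡y) | no x≢y = ⊥-elim (x≢y x≡y)
  indexOf-< (y ∷ ys) (there x∈) | no _ = s≤s (indexOf-< ys x∈)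

  nth-tabulate : ∀ {n} (f : Fin n → ℕ) i → nth (tabulate f) (toℕ i) ≡ f i
  nth-tabulate f zero = refl
  nth-tabulate f (suc i) = nth-tabulate (f ∘ suc) i

  words : ℕ → ℕ → List (List ℕ)
  words N zero = [] ∷ []
  words N (suc n) = cartesianProductWith _∷_ (upTo N) (words N n)

  tabulate-∈-words : ∀ {n N} (f : Fin n → ℕ) → (∀ i → f i < N) → tabulate f ∈ words N n
  tabulate-∈-words {zero} f f< = here refl
  tabulate-∈-words {suc n} f f< =
    ∈-cartesianProductWith⁺ _∷_ (∈-upTo⁺ (f< zero)) (tabulate-∈-words (f ∘ suc) (f< ∘ suc))

  -- Where `s` undoes `r`, an entry renamed to `m` can only have been `s m`: renaming merges no two
  -- machines.
  count-relabel : ∀ (r s : ℕ → ℕ) m xs → All (λ x → s (r x) ≡ x) xs → count m (map r xs) ≤ count (s m) xs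
  count-relabel r s m [] [] = z≤n
  count-relabel r s m (x ∷ xs) (sr ∷ all) = step (r x ≟ m)
    where
    ih = count-relabel r s m xs all
    step : Dec (r x ≡ m) → count m (r x ∷ map r xs) ≤ count (s m) (x ∷ xs)
    step (yes e) = subst₂ _≤_ (sym (cong length (filter-accept (_≟ m) e)))
      (sym (cong length (filter-accept (_≟ s m) (trans (sym sr) (cong s e))))) (s≤s ih)
    step (no ne) = ≤-trans (≤-reflexive (cong length (filter-reject (_≟ m) ne))) (≤-trans ih (grow (x ≟ s m)))
      where
      grow : Dec (x ≡ s m) → count (s m) xs ≤ count (s m) (x ∷ xs)
      grow (yes e) = ≤-trans (n≤1+n _) (≤-reflexive (sym (cong length (filter-accept (_≟ s m) e))))
      grow (no ne′) = ≤-reflexive (sym (cong length (filter-reject (_≟ s m) ne′)))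

  count-∉ : ∀ m xs → m ∉ xs → count m xs ≡ 0
  count-∉ m xs m∉ = cong length (filter-none (_≟ m) (All.tabulate λ { x∈ refl → m∉ x∈ }))

  on-∈ : ∀ {t m} pl → m ∈ on t pl → m ∈ map proj₂ pl
  on-∈ {t} pl m∈ with ∈-map⁻ proj₂ m∈
  ... | x , x∈ , refl = ∈-map⁺ proj₂ (proj₁ (∈-filter⁻ (active? t ∘ proj₁) {xs = pl} x∈))

  on-∅ : ∀ {t} pl → All (λ p → ¬ Active t (proj₁ p)) pl → on t pl ≡ []
  on-∅ {t} pl all = cong (map proj₂) (filter-none (active? t ∘ proj₁) all)

  -- Names and times are unbounded, but a count is positive only for a machine in use and at a time
  -- before `B`, so finitely many checks decide.
  Fits? : ∀ g B pl → All (λ p → end (proj₁ p) ≤ B) pl → Dec (Fits g pl)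
  Fits? g B pl ends = map′ ⇒ ⇐ (All.all? (λ m → All.all? (λ t → count m (on t pl) ≤? g) (upTo B)) (map proj₂ pl))
    where
    ⇒ : All (λ m → All (λ t → count m (on t pl) ≤ g) (upTo B)) (map proj₂ pl) → Fits g pl
    ⇒ all m t with _∈?_ _≟_ m (map proj₂ pl)
    ... | no m∉ = subst (_≤ g) (sym (count-∉ m (on t pl) (m∉ ∘ on-∈ pl))) z≤n
    ... | yes m∈ with t <? B
    ...   | yes t<B = All.lookup (All.lookup all m∈) (∈-upTo⁺ t<B)
    ...   | no t≮B = subst (λ ms → count m ms ≤ g) (sym (on-∅ pl (All.map (λ { e≤B (_ , t<e) → t≮B (≤-trans t<e e≤B) }) ends))) z≤n
    ⇐ : Fits g pl → All (λ m → All (λ t → count m (on t pl) ≤ g) (upTo B)) (map proj₂ pl)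
    ⇐ fits = All.universal (λ m → All.universal (λ t → fits m t) (upTo B)) (map proj₂ pl)

  module _ (I : Instance) (g : ℕ) .{{_ : NonZero g}} (sizes≡ : All (λ J → size J ≡ 1 /ₙ g) (intervals I)) where
    private
      n : ℕ
      n = length (intervals I)

      fromWord : List ℕ → Schedule I
      fromWord ms i = nth ms (toℕ i)

    feasible? : ∀ σ → Dec (Feasible I σ)
    feasible? σ = map′ (Fits⇒Feasible I σ g sizes≡) (Feasible⇒Fits I σ g sizes≡)
      (Fits? g (suc (horizon I)) (placed I σ)
        (All.map⁺ (All.universal (λ i → proj₂ (All.lookup (inHorizon I) (∈-lookup i))) (allFin n))))

    module _ (σ : Schedule I) where
      private
        r s : ℕ → ℕ
        r = indexOf (tabulate σ)
        s = nth (tabulate σ)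

      -- Any natural number may name a machine, so the schedules to be minimised over are infinitely
      -- many. Naming a machine by the first position at which `σ` uses it keeps the names below the
      -- number of requests, preserves feasibility and does not raise the cost; the minimum over
      -- finitely many words of names is then the optimum.
      relabelled : Schedule I
      relabelled = fromWord (tabulate (r ∘ σ))

      on-relabelled : ∀ t → on t (placed I relabelled) ≡ map r (on t (placed I σ))
      on-relabelled t = begin
        on t (placed I relabelled)                  ≡⟨ sym (map-σ-active I relabelled t) ⟩
        map relabelled (activeIndices I σ t)        ≡⟨ map-cong (nth-tabulate (r ∘ σ)) (activeIndices I σ t) ⟩
        map (r ∘ σ) (activeIndices I σ t)           ≡⟨ map-∘ (activeIndices I σ t) ⟩
        map r (map σ (activeIndices I σ t))         ≡⟨ cong (map r) (map-σ-active I σ t) ⟩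
        map r (on t (placed I σ))                   ∎
        where open ≡-Reasoning

      relabelled-cost : cost I relabelled ≤ cost I σ
      relabelled-cost = subst₂ _≤_ (sym (cost-placed I relabelled)) (sym (cost-placed I σ))
        (Σ<-mono (horizon I) (λ t _ → subst (λ ms → distinct ms ≤ bins (suc t) (placed I σ)) (sym (on-relabelled (suc t)))
          (distinct-map r (on (suc t) (placed I σ)))))

      relabelled-feasible : Feasible I σ → Feasible I relabelled
      relabelled-feasible feas = Fits⇒Feasible I relabelled g sizes≡ λ m t → begin
        count m (on t (placed I relabelled))   ≡⟨ cong (count m) (on-relabelled t) ⟩
        count m (map r (on t (placed I σ)))    ≤⟨ count-relabel r s m (on t (placed I σ)) (inverse t) ⟩
        count (s m) (on t (placed I σ))        ≤⟨ Feasible⇒Fits I σ g sizes≡ feas (s m) t ⟩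
        g                                      ∎
        where
        open ≤-Reasoning
        inverse : ∀ t → All (λ x → s (r x) ≡ x) (on t (placed I σ))
        inverse t = subst (All _) (map-σ-active I σ t)
          (All.map⁺ (All.universal (λ i → nth-indexOf (tabulate σ) (∈-tabulate⁺ i)) (activeIndices I σ t)))

      relabelled-∈ : relabelled ∈ map fromWord (words n n)
      relabelled-∈ = ∈-map⁺ fromWord (tabulate-∈-words (r ∘ σ)
        (λ i → subst (r (σ i) <_) (length-tabulate σ) (indexOf-< (tabulate σ) (∈-tabulate⁺ i))))

    OPT-exists : ∀ σ₀ → Feasible I σ₀ → ∃[ opt ] IsOPT I opt
    OPT-exists σ₀ feas₀ = cost I best , (best , argmin-all (cost I) feas₀ (All.all-filter feasible? all) , refl) , λ σ feas → begin
      cost I best             ≤⟨ All.lookup (f[argmin]≤f[xs] {f = cost I} σ₀ candidates) (∈-filter⁺ feasible? (relabelled-∈ σ) (relabelled-feasible σ feas)) ⟩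
      cost I (relabelled σ)   ≤⟨ relabelled-cost σ ⟩
      cost I σ                ∎
      where
      open ≤-Reasoning
      all candidates : List (Schedule I)
      all = map fromWord (words n n)
      candidates = filter feasible? all
      best : Schedule I
      best = argmin (cost I) σ₀ candidates

  -- Dyadic blocks and the offline packing

  2*⌊n/2⌋≤n : ∀ n → 2 * ⌊ n /2⌋ ≤ n
  2*⌊n/2⌋≤n zero = z≤n
  2*⌊n/2⌋≤n (suc zero) = z≤n
  2*⌊n/2⌋≤n (suc (suc n)) = ≤-trans (≤-reflexive (*-suc 2 ⌊ n /2⌋)) (s≤s (s≤s (2*⌊n/2⌋≤n n)))

  n≤1+2*⌊n/2⌋ : ∀ n → n ≤ 1 + 2 * ⌊ n /2⌋
  n≤1+2*⌊n/2⌋ zero = z≤n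
  n≤1+2*⌊n/2⌋ (suc zero) = ≤-refl
  n≤1+2*⌊n/2⌋ (suc (suc n)) = ≤-trans (s≤s (s≤s (n≤1+2*⌊n/2⌋ n))) (≤-reflexive (cong suc (sym (*-suc 2 ⌊ n /2⌋))))

  -- block j t = ⌊ t / 2ʲ ⌋
  block : ℕ → ℕ → ℕ
  block zero t = t
  block (suc j) t = ⌊ block j t /2⌋

  block-lower : ∀ j t → block j t * 2 ^ j ≤ t
  block-lower zero t = ≤-reflexive (*-identityʳ t)
  block-lower (suc j) t = begin
    ⌊ b /2⌋ * (2 * 2 ^ j)  ≡⟨ rearrange ⌊ b /2⌋ (2 ^ j) ⟩
    2 * ⌊ b /2⌋ * 2 ^ j    ≤⟨ *-monoˡ-≤ (2 ^ j) (2*⌊n/2⌋≤n b) ⟩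
    b * 2 ^ j              ≤⟨ block-lower j t ⟩
    t                      ∎
    where
    open ≤-Reasoning
    b = block j t
    rearrange : ∀ x y → x * (2 * y) ≡ 2 * x * y
    rearrange = solve-∀

  block-upper : ∀ j t → t < suc (block j t) * 2 ^ j
  block-upper zero t = s≤s (≤-reflexive (sym (*-identityʳ t)))
  block-upper (suc j) t = begin-strict
    t                          <⟨ block-upper j t ⟩
    suc b * 2 ^ j              ≤⟨ *-monoˡ-≤ (2 ^ j) (s≤s (n≤1+2*⌊n/2⌋ b)) ⟩
    (2 + 2 * ⌊ b /2⌋) * 2 ^ j  ≡⟨ rearrange ⌊ b /2⌋ (2 ^ j) ⟩
    suc ⌊ b /2⌋ * (2 * 2 ^ j)  ∎
    where
    open ≤-Reasoning
    b = block j t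
    rearrange : ∀ x y → (2 + 2 * x) * y ≡ suc x * (2 * y)
    rearrange = solve-∀

  block-unique : ∀ j b t → b * 2 ^ j ≤ t → t < suc b * 2 ^ j → block j t ≡ b
  block-unique j b t l u = ≤-antisym
    (≤-pred (*-cancelʳ-< (2 ^ j) (block j t) (suc b) (≤-<-trans (block-lower j t) u)))
    (≤-pred (*-cancelʳ-< (2 ^ j) b (suc (block j t)) (≤-<-trans l (block-upper j t))))

  -- Each block is a union of two blocks of the next lower level. This is the laminarity on which
  -- the packing rests.
  block-coarsen : ∀ {i j s t} → i ≤ j → block i s ≡ block i t → block j s ≡ block j t
  block-coarsen {i} {j} i≤j eq with m≤n⇒m<n∨m≡n i≤j
  ... | inj₂ refl = eq
  block-coarsen {i} {suc j} _ eq | inj₁ (s≤s i≤j) = cong ⌊_/2⌋ (block-coarsen i≤j eq)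

  -- (t , j) stands for the request that arrives at time suc t and runs to the end of the dyadic block of length 2ʲ around it.
  Label : Set
  Label = ℕ × ℕ

  -- Offline, a request reserves its whole block, including the part before its arrival. Active
  -- times of requests may cross, whereas the reserved blocks are laminar. Here `τ` stands for the
  -- time step `suc τ`.
  Covers : ℕ → Label → Set
  Covers τ (t , j) = block j τ ≡ block j t

  covers? : ∀ τ x → Dec (Covers τ x)
  covers? τ (t , j) = block j τ ≟ block j t

  module _ (g : ℕ) .{{_ : NonZero g}} where

    item : Label → Interval
    item (t , j) = interval (suc t) (suc (suc (block j t) * 2 ^ j)) (1 /ₙ g)

    Active⇒Covers : ∀ {τ} x → Active (suc τ) (item x) → Covers τ x
    Active⇒Covers {τ} (t , j) (s≤s t≤τ , s≤s τ<e) =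
      block-unique j (block j t) τ (≤-trans (block-lower j t) t≤τ) τ<e

    start-Active : ∀ x → Active (suc (proj₁ x)) (item x)
    start-Active (t , j) = ≤-refl , s≤s (block-upper j t)

  covering : ℕ → List Label → ℕ
  covering τ = length ∘ filter (covers? τ)

  filter-⊂-length : ∀ {a p q} {A : Set a} {P : Pred A p} {Q : Pred A q} (P? : Decidable P) (Q? : Decidable Q) →
    (∀ {x} → P x → Q x) → ∀ {xs y} → y ∈ xs → Q y → ¬ P y → length (filter P? xs) < length (filter Q? xs)
  filter-⊂-length P? Q? imp {xs} y∈ qy ¬py = ≤-<-trans
    (≤-reflexive (cong length (sym (filter-filter xs))))
    (filter-notAll P? (filter Q? xs) (lose (∈-filter⁺ Q? y∈ qy) ¬py))
    where
    filter-filter : ∀ xs → filter P? (filter Q? xs) ≡ filter P? xs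
    filter-filter [] = refl
    filter-filter (x ∷ xs) with Q? x
    ... | yes q with P? x
    ...   | yes _ = cong (x ∷_) (filter-filter xs)
    ...   | no _ = filter-filter xs
    filter-filter (x ∷ xs) | no ¬q with P? x
    ...   | yes p = ⊥-elim (¬q (imp p))
    ...   | no _ = filter-filter xs

  Unique-map-∈ : ∀ {a b} {A : Set a} {B : Set b} (f : A → B) xs → Unique xs →
    (∀ {x y} → x ∈ xs → y ∈ xs → x ≢ y → f x ≢ f y) → Unique (map f xs)
  Unique-map-∈ f [] [] inj = []
  Unique-map-∈ f (x ∷ xs) (x∉ ∷ u) inj =
    All.map⁺ (All.tabulate (λ y∈ → inj (here refl) (there y∈) (All.lookup x∉ y∈))) ∷
    Unique-map-∈ f xs u (λ x∈ y∈ → inj (there x∈) (there y∈))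

  -- Higher levels come first, so the block of any request before `x` either contains the block of
  -- `x` or is disjoint from it. Ties are broken by start time.
  Before : Label → Label → Set
  Before (s , i) (t , j) = j < i ⊎ (j ≡ i × s < t)

  before? : ∀ x y → Dec (Before x y)
  before? (s , i) (t , j) = (j <? i) ⊎-dec ((j ≟ i) ×-dec (s <? t))

  Before-irrefl : ∀ {x} → ¬ Before x x
  Before-irrefl (inj₁ p) = <-irrefl refl p
  Before-irrefl (inj₂ (_ , p)) = <-irrefl refl p

  Before-trans : ∀ {x y z} → Before x y → Before y z → Before x z
  Before-trans (inj₁ p) (inj₁ q) = inj₁ (<-trans q p)
  Before-trans (inj₁ p) (inj₂ (refl , _)) = inj₁ p
  Before-trans (inj₂ (refl , _)) (inj₁ q) = inj₁ q
  Before-trans (inj₂ (refl , p)) (inj₂ (refl , q)) = inj₂ (refl , <-trans p q)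

  Before-total : ∀ x y → x ≢ y → Before x y ⊎ Before y x
  Before-total (s , i) (t , j) ne with <-cmp i j | <-cmp s t
  ... | tri< p _ _ | _ = inj₂ (inj₁ p)
  ... | tri> _ _ p | _ = inj₁ (inj₁ p)
  ... | tri≈ _ refl _ | tri< p _ _ = inj₁ (inj₂ (refl , p))
  ... | tri≈ _ refl _ | tri≈ _ refl _ = ⊥-elim (ne refl)
  ... | tri≈ _ refl _ | tri> _ _ p = inj₂ (inj₂ (refl , p))

  Before⇒≤ : ∀ {x y} → Before x y → proj₂ y ≤ proj₂ x
  Before⇒≤ (inj₁ p) = <⇒≤ p
  Before⇒≤ (inj₂ (refl , _)) = ≤-refl

  module _ (g : ℕ) .{{_ : NonZero g}} (R : List Label) where

    rank : ℕ → Label → ℕ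
    rank τ x = length (filter (λ y → before? y x ×-dec covers? τ y) R)

    -- Dyadic blocks are laminar, so at every time of the block of x the earlier covering requests are the same: x keeps its rank.
    rank-constant : ∀ {τ} x → Covers τ x → rank (proj₁ x) x ≡ rank τ x
    rank-constant x@(t , j) τ~t = cong length (filter-≐ _ _
      ((λ { {y} (b , c) → b , trans (block-coarsen (Before⇒≤ {y} {x} b) τ~t) c }) ,
       (λ { {y} (b , c) → b , trans (sym (block-coarsen (Before⇒≤ {y} {x} b) τ~t)) c })) R)

    rank-< : ∀ {τ x} → x ∈ R → Covers τ x → rank τ x < covering τ R
    rank-< {τ} {x} x∈ c = filter-⊂-length _ (covers? τ) proj₂ x∈ c (λ { (b , _) → Before-irrefl {x} b })

    rank-mono : ∀ {τ x y} → x ∈ R → Covers τ x → Before x y → rank τ x < rank τ y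
    rank-mono {τ} {x} {y} x∈ c x<y = filter-⊂-length _ _ (λ { {z} (b , c′) → Before-trans {z} {x} {y} b x<y , c′ })
      x∈ (x<y , c) (λ { (b , _) → Before-irrefl {x} b })

    rank-injective : ∀ {τ x y} → x ∈ R → y ∈ R → Covers τ x → Covers τ y → x ≢ y → rank τ x ≢ rank τ y
    rank-injective {τ} {x} {y} x∈ y∈ cx cy ne eq with Before-total x y ne
    ... | inj₁ b = <-irrefl eq (rank-mono {τ} {x} {y} x∈ cx b)
    ... | inj₂ b = <-irrefl (sym eq) (rank-mono {τ} {y} {x} y∈ cy b)

    -- The requests covering a time are stacked in the order `Before` and cut into groups of `g`.
    -- Reading the rank at the arrival is enough, because it is the same throughout the block.
    machine : Label → ℕ
    machine x = rank (proj₁ x) x / g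

    packed : List Placed
    packed = map (λ x → item g x , machine x) R

    activeLabels : ℕ → List Label
    activeLabels t = filter (active? t ∘ item g) R

    on-packed : ∀ t → on t packed ≡ map machine (activeLabels t)
    on-packed t = trans (cong (map proj₂) (filter-map (active? t ∘ proj₁) (λ x → item g x , machine x) R))
      (sym (map-∘ (activeLabels t)))

    active-∈ : ∀ {τ x} → x ∈ activeLabels (suc τ) → x ∈ R × Covers τ x
    active-∈ {τ} {x} x∈ with ∈-filter⁻ (active? (suc τ) ∘ item g) {xs = R} x∈
    ... | x∈R , act = x∈R , Active⇒Covers g x act

    -- Ranks at `τ` lie below the number of covering requests, so the machine names, being their
    -- quotients by `g`, lie below that number's rounded-up quotient.
    packed-bins : ∀ τ → bins (suc τ) packed ≤ ⌈ covering τ R /⌉ g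
    packed-bins τ = subst (λ ms → distinct ms ≤ ⌈ covering τ R /⌉ g) (sym (on-packed (suc τ)))
      (distinct-< (All.map⁺ (All.tabulate λ {x} x∈ → bound x (active-∈ x∈))))
      where
      bound : ∀ x → x ∈ R × Covers τ x → machine x < ⌈ covering τ R /⌉ g
      bound x (x∈ , c) = m<n*o⇒m/o<n (<-≤-trans
        (subst (_< covering τ R) (sym (rank-constant x c)) (rank-< x∈ c)) (proj₁ (⌈/⌉-isCeil (covering τ R) g)))

    packed-Fits : Unique R → Fits g packed
    packed-Fits u m zero = subst (_≤ g)
      (sym (cong (count m) (trans (on-packed 0) (cong (map machine) (filter-none (active? 0 ∘ item g) (All.universal (λ _ ()) R)))))) z≤n
    packed-Fits u m (suc τ) = begin
      count m (on (suc τ) packed)                ≡⟨ cong (count m) (trans (on-packed (suc τ)) (map-∘ {g = _/ g} {f = position} A)) ⟩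
      count m (map (_/ g) (map position A))           ≤⟨ count-quotients g m (map position A) (Unique-map-∈ position A (Unique.filter⁺ _ u) position-injective) ⟩
      g                                          ∎
      where
      open ≤-Reasoning
      A = activeLabels (suc τ)
      position : Label → ℕ
      position x = rank (proj₁ x) x
      position-injective : ∀ {x y} → x ∈ A → y ∈ A → x ≢ y → position x ≢ position y
      position-injective {x} {y} x∈ y∈ ne eq with active-∈ x∈ | active-∈ y∈
      ... | x∈R , cx | y∈R , cy = rank-injective {τ} {x} {y} x∈R y∈R cx cy ne
        (trans (sym (rank-constant x cx)) (trans eq (rank-constant y cy)))

    numActive-≤-covering : ∀ τ → numActive (suc τ) (map (item g) R) ≤ covering τ R
    numActive-≤-covering τ = begin
      length (filter (active? (suc τ)) (map (item g) R))  ≡⟨ cong length (filter-map (active? (suc τ)) (item g) R) ⟩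
      length (map (item g) (activeLabels (suc τ)))        ≡⟨ length-map (item g) (activeLabels (suc τ)) ⟩
      length (activeLabels (suc τ))                       ≤⟨ filter-⊆-length _ (covers? τ) (λ {x} → Active⇒Covers g x) R ⟩
      covering τ R                                        ∎
      where open ≤-Reasoning

  -- The adversary

  -- In this form, evenness of `block j t` reads `2 * block (suc j) t ≡ block j t`: the time `t`
  -- lies in the left half of its block at level `suc j`.
  Even : ℕ → Set
  Even n = 2 * ⌊ n /2⌋ ≡ n

  even? : ∀ n → Dec (Even n)
  even? zero = yes refl
  even? (suc zero) = no λ ()
  even? (suc (suc n)) = map′
    (λ e → trans (*-suc 2 ⌊ n /2⌋) (cong (2 +_) e))
    (λ e → suc-injective (suc-injective (trans (sym (*-suc 2 ⌊ n /2⌋)) e)))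
    (even? n)

  isEven : ℕ → ℕ
  isEven n = if does (even? n) then 1 else 0

  isEven-yes : ∀ {n} → Even n → isEven n ≡ 1
  isEven-yes {n} e = cong (if_then 1 else 0) (dec-true (even? n) e)

  isEven-no : ∀ {n} → ¬ Even n → isEven n ≡ 0
  isEven-no {n} e = cong (if_then 1 else 0) (dec-false (even? n) e)

  Σ<-isEven : ∀ m → Σ< (m * 2) isEven ≡ m
  Σ<-isEven zero = refl
  Σ<-isEven (suc m) = trans (Σ<-split 2 (m * 2) isEven) (cong suc (Σ<-isEven m))

  Σ<-block : ∀ j M (f : ℕ → ℕ) → Σ< (M * 2 ^ j) (f ∘ block j) ≡ 2 ^ j * Σ< M f
  Σ<-block j zero f = sym (*-zeroʳ (2 ^ j))
  Σ<-block j (suc M) f = begin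
    Σ< (2 ^ j + M * 2 ^ j) h                            ≡⟨ cong (λ k → Σ< k h) (+-comm (2 ^ j) (M * 2 ^ j)) ⟩
    Σ< (M * 2 ^ j + 2 ^ j) h                            ≡⟨ Σ<-split (M * 2 ^ j) (2 ^ j) h ⟩
    Σ< (M * 2 ^ j) h + Σ< (2 ^ j) (λ i → h (M * 2 ^ j + i))
      ≡⟨ cong₂ _+_ (Σ<-block j M f) (trans (Σ<-cong (2 ^ j) (λ i i< → cong f (inBlock i i<))) (Σ<-const (2 ^ j) (f M))) ⟩
    2 ^ j * Σ< M f + 2 ^ j * f M                        ≡⟨ sym (*-distribˡ-+ (2 ^ j) (Σ< M f) (f M)) ⟩
    2 ^ j * Σ< (suc M) f                                ∎
    where
    open ≡-Reasoning
    h = f ∘ block j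
    inBlock : ∀ i → i < 2 ^ j → block j (M * 2 ^ j + i) ≡ M
    inBlock i i< = block-unique j M _ (m≤m+n _ i)
      (≤-trans (+-monoʳ-< (M * 2 ^ j) i<) (≤-reflexive (+-comm (M * 2 ^ j) (2 ^ j))))

  -- The number of levels i ∈ [j , j + r) for which t lies in the left half of its block of length 2ⁱ⁺¹.
  numFree : ℕ → ℕ → ℕ → ℕ
  numFree t j zero = 0
  numFree t j (suc r) = isEven (block j t) + numFree t (suc j) r

  -- On a range made of whole blocks of length `2 ^ (j + r)`, each of the `r` levels is free at
  -- exactly half of the times. The induction peels off the lowest level, which is why `j` varies.
  Σ<-numFree : ∀ M j r → 2 * Σ< (M * 2 ^ (j + r)) (λ t → numFree t j r) ≡ r * (M * 2 ^ (j + r))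
  Σ<-numFree M j zero = cong (2 *_) (trans (Σ<-const (M * 2 ^ (j + 0)) 0) (*-zeroʳ (M * 2 ^ (j + 0))))
  Σ<-numFree M j (suc r) = begin
    2 * Σ< N (λ t → isEven (block j t) + numFree t (suc j) r)
      ≡⟨ cong (2 *_) (Σ<-+ N (isEven ∘ block j) (λ t → numFree t (suc j) r)) ⟩
    2 * (Σ< N (isEven ∘ block j) + Σ< N (λ t → numFree t (suc j) r))
      ≡⟨ *-distribˡ-+ 2 (Σ< N (isEven ∘ block j)) _ ⟩
    2 * Σ< N (isEven ∘ block j) + 2 * Σ< N (λ t → numFree t (suc j) r)
      ≡⟨ cong₂ _+_ half rest ⟩
    N + r * N ∎
    where
    open ≡-Reasoning
    N = M * 2 ^ (j + suc r)
    rearrange : ∀ M a b → M * (a * (2 * b)) ≡ M * b * 2 * a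
    rearrange = solve-∀
    N≡ : N ≡ M * 2 ^ r * 2 * 2 ^ j
    N≡ = trans (cong (M *_) (^-distribˡ-+-* 2 j (suc r))) (rearrange M (2 ^ j) (2 ^ r))
    half : 2 * Σ< N (isEven ∘ block j) ≡ N
    half = begin
      2 * Σ< N (isEven ∘ block j)                     ≡⟨ cong (λ k → 2 * Σ< k (isEven ∘ block j)) N≡ ⟩
      2 * Σ< (M * 2 ^ r * 2 * 2 ^ j) (isEven ∘ block j) ≡⟨ cong (2 *_) (Σ<-block j (M * 2 ^ r * 2) isEven) ⟩
      2 * (2 ^ j * Σ< (M * 2 ^ r * 2) isEven)         ≡⟨ cong (λ k → 2 * (2 ^ j * k)) (Σ<-isEven (M * 2 ^ r)) ⟩
      2 * (2 ^ j * (M * 2 ^ r))                       ≡⟨ commute (2 ^ j) (M * 2 ^ r) ⟩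
      M * 2 ^ r * 2 * 2 ^ j                           ≡⟨ sym N≡ ⟩
      N                                               ∎
      where
      commute : ∀ a b → 2 * (a * b) ≡ b * 2 * a
      commute = solve-∀
    rest : 2 * Σ< N (λ t → numFree t (suc j) r) ≡ r * N
    rest = trans (cong (λ k → 2 * Σ< (M * 2 ^ k) (λ t → numFree t (suc j) r)) (+-suc j r))
      (trans (Σ<-numFree M (suc j) r) (cong (λ k → r * (M * 2 ^ k)) (sym (+-suc j r))))

  _⊑_ : ∀ {a} {A : Set a} → List A → List A → Set a
  xs ⊑ ys = ∃[ zs ] ys ≡ xs ++ zs

  ⊑-refl : ∀ {a} {A : Set a} {xs : List A} → xs ⊑ xs
  ⊑-refl {xs = xs} = [] , sym (++-identityʳ xs)

  ⊑-trans : ∀ {a} {A : Set a} {xs ys zs : List A} → xs ⊑ ys → ys ⊑ zs → xs ⊑ zs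
  ⊑-trans {xs = xs} (us , refl) (vs , refl) = us ++ vs , ++-assoc xs us vs

  ⊑-∷ʳ : ∀ {a} {A : Set a} {xs : List A} {x} → xs ⊑ (xs ∷ʳ x)
  ⊑-∷ʳ {x = x} = x ∷ [] , refl

  ⊑⇒⊆ : ∀ {a} {A : Set a} {xs ys : List A} → xs ⊑ ys → xs ⊆ ys
  ⊑⇒⊆ (zs , refl) = ∈-++⁺ˡ

  -- Both decisions are arguments, so that `choose-elim` proves a property of `release` one branch
  -- at a time.
  choose : ∀ {a b x} {A : Set a} {B : Set b} {X : Set x} → Dec A → Dec B → X → X → X → X
  choose (no _) _ x y z = x
  choose (yes _) (yes _) x y z = y
  choose (yes _) (no _) x y z = z

  choose-elim : ∀ {a b x q} {A : Set a} {B : Set b} {X : Set x} (Q : X → Set q) (A? : Dec A) (B? : Dec B) {x y z : X} →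
    (¬ A → Q x) → (A → B → Q y) → (A → ¬ B → Q z) → Q (choose A? B? x y z)
  choose-elim Q (no ¬a) _ qx qy qz = qx ¬a
  choose-elim Q (yes a) (yes b) qx qy qz = qy a b
  choose-elim Q (yes a) (no ¬b) qx qy qz = qz a ¬b

  infix 4 _≺_
  _≺_ : Label → Label → Set
  (s , i) ≺ (t , j) = s < t ⊎ (s ≡ t × i < j)

  ≺⇒≢ : ∀ {x y} → x ≺ y → x ≢ y
  ≺⇒≢ (inj₁ s<t) refl = <-irrefl refl s<t
  ≺⇒≢ (inj₂ (_ , i<j)) refl = <-irrefl refl i<j

  AllPairs-∷ʳ : ∀ {a ℓ} {A : Set a} {R : A → A → Set ℓ} {xs x} → AllPairs R xs → All (λ y → R y x) xs → AllPairs R (xs ∷ʳ x)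
  AllPairs-∷ʳ ps all = AllPairs.++⁺ ps ([] ∷ []) (All.map (_∷ []) all)

  -- A request counts with the length of its whole block, since that is what the packing reserves.
  -- For a request released in a left half this is at most twice its duration.
  extent : List Label → ℕ
  extent R = sum (map (λ x → 2 ^ proj₂ x) R)

  extent-∷ʳ : ∀ R x → extent (R ∷ʳ x) ≡ extent R + 2 ^ proj₂ x
  extent-∷ʳ R x = trans (cong sum (map-++ _ R (x ∷ []))) (trans (sum-++ (map _ R) _) (cong (extent R +_) (+-identityʳ _)))

  module Adversary (g : ℕ) {{_ : NonZero g}} (ρ : List Interval → Interval → ℕ) (L : ℕ) where

    requests : List Label → List Interval
    requests = map (item g)

    played : List Label → List Placed
    played R = play ρ [] (requests R)

    open-bins : ℕ → List Label → ℕ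
    open-bins t R = bins (suc t) (played R)

    target : ℕ → ℕ
    target t = numFree t 0 L

    -- `r` counts the levels left. Parity at level `j` tells the halves of the block at level
    -- `suc j`, hence the shift in the label. The target is tested before each release, so a request
    -- is made only while the target is still missed.
    release : ℕ → ℕ → ℕ → List Label → List Label
    release t j zero R = R
    release t j (suc r) R = choose (even? (block j t)) (target t ≤? g * open-bins t R)
      (release t (suc j) r R) R (release t (suc j) r (R ∷ʳ (t , suc j)))

    phase : ℕ → List Label
    phase zero = []
    -- The unit request keeps the step busy, as no step of an instance may be idle.
    phase (suc t) = release t 0 L (phase t ∷ʳ (t , 0))

    played-⊑ : ∀ {R S} → R ⊑ S → played R ⊑ played S
    played-⊑ {R} (zs , refl) = play ρ (requests R) (requests zs) , trans (cong (play ρ []) (map-++ (item g) R zs)) (play-++ ρ [] (requests R) (requests zs))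

    played-∷ʳ : ∀ R x → played (R ∷ʳ x) ≡ played R ∷ʳ (item g x , ρ (requests R) (item g x))
    played-∷ʳ R x = proj₂ (played-⊑ {R} ⊑-∷ʳ)

    open-bins-mono : ∀ t {R S} → R ⊑ S → open-bins t R ≤ open-bins t S
    open-bins-mono t {R} R⊑S with played-⊑ R⊑S
    ... | zs , eq = subst (λ p → open-bins t R ≤ bins (suc t) p) (sym eq) (bins-mono-++ (suc t) (played R) zs)

    on-played-mono : ∀ t {R S} → R ⊑ S → on t (played R) ⊆ on t (played S)
    on-played-mono t {R} R⊑S m∈ with played-⊑ R⊑S
    ... | zs , eq = subst (λ p → _ ∈ on t p) (sym eq) (on-⊆-++ t (played R) zs m∈)

    Fits-⊑ : ∀ {R S} → R ⊑ S → Fits g (played S) → Fits g (played R)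
    Fits-⊑ {R} R⊑S fits with played-⊑ R⊑S
    ... | zs , eq = Fits-++ˡ (played R) zs (subst (Fits g) eq fits)

    release-⊑ : ∀ t j r R → R ⊑ release t j r R
    release-⊑ t j zero R = ⊑-refl
    release-⊑ t j (suc r) R = choose-elim (R ⊑_) (even? (block j t)) (target t ≤? g * open-bins t R)
      (λ _ → release-⊑ t (suc j) r R) (λ _ _ → ⊑-refl)
      (λ _ _ → ⊑-trans ⊑-∷ʳ (release-⊑ t (suc j) r (R ∷ʳ (t , suc j))))

    phase-⊑-suc : ∀ t → phase t ⊑ phase (suc t)
    phase-⊑-suc t = ⊑-trans ⊑-∷ʳ (release-⊑ t 0 L (phase t ∷ʳ (t , 0)))

    phase-⊑ : ∀ t n → phase t ⊑ phase (n + t)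
    phase-⊑ t zero = ⊑-refl
    phase-⊑ t (suc n) = ⊑-trans (phase-⊑ t n) (phase-⊑-suc (n + t))

    numActive-∷ʳ : ∀ t R j → numActive (suc t) (requests (R ∷ʳ (t , j))) ≡ suc (numActive (suc t) (requests R))
    numActive-∷ʳ t R j = begin
      length (filter A? (requests (R ∷ʳ (t , j))))          ≡⟨ cong (length ∘ filter A?) (map-++ (item g) R _) ⟩
      length (filter A? (requests R ∷ʳ item g (t , j)))     ≡⟨ cong length (filter-++ A? (requests R) _) ⟩
      length (filter A? (requests R) ++ filter A? (item g (t , j) ∷ []))
        ≡⟨ cong (λ Js → length (filter A? (requests R) ++ Js)) (filter-all A? (start-Active g (t , j) ∷ [])) ⟩
      length (filter A? (requests R) ∷ʳ item g (t , j))     ≡⟨ length-++ (filter A? (requests R)) ⟩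
      length (filter A? (requests R)) + 1                   ≡⟨ +-comm _ 1 ⟩
      suc (numActive (suc t) (requests R))                  ∎
      where
      open ≡-Reasoning
      A? = active? (suc t)

    active-≤-open-bins : ∀ t R → Fits g (played R) → numActive (suc t) (requests R) ≤ g * open-bins t R
    active-≤-open-bins t R fits = subst (_≤ g * open-bins t R)
      (trans (length-on (suc t) (played R)) (cong (numActive (suc t)) (map-proj₁-play ρ [] (requests R))))
      (length-≤-distinct (on (suc t) (played R)) (λ m → fits m (suc t)))

    record Opens (t : ℕ) (R R′ : List Label) : Set where
      field
        before : List Label
        level  : ℕ
        extends : R ⊑ before
        last-request : R′ ≡ before ∷ʳ (t , suc level)
        free : Even (block level t)
        fresh : ρ (requests before) (item g (t , suc level)) ∉ on (suc t) (played before)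

    -- The levels released after `R` start at `suc j` or above and increase strictly to that of the
    -- last request. Their block lengths sum to at most `2 * 2 ^ suc level - 2 ^ suc j`, a geometric
    -- series; the subtracted term, moved to the left, lets the induction close.
    Outcome : ℕ → ℕ → List Label → List Label → Set
    Outcome t j R R′ = R′ ≡ R ⊎ ∃[ o ] extent R′ + 2 ^ suc j ≤ extent R + 2 * 2 ^ suc (Opens.level {t} {R} {R′} o)

    fresh-machine : ∀ t j R → open-bins t R < open-bins t (R ∷ʳ (t , j)) →
      ρ (requests R) (item g (t , j)) ∉ on (suc t) (played R)
    fresh-machine t j R lt m∈ = <⇒≱ lt (distinct-mono λ {x} x∈ →
      [ id , (λ p → sub p) ]′ (∈-++⁻ (on (suc t) (played R))
        (subst (x ∈_) (trans (cong (on (suc t)) (played-∷ʳ R (t , j))) (on-++ (suc t) (played R) _)) x∈)))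
      where
      new : List Placed
      new = (item g (t , j) , ρ (requests R) (item g (t , j))) ∷ []
      sub : on (suc t) new ⊆ on (suc t) (played R)
      sub x∈ with subst (_ ∈_) (cong (map proj₂) (filter-all (active? (suc t) ∘ proj₁) {xs = new} (start-Active g (t , j) ∷ []))) x∈
      ... | here refl = m∈

    -- The first hypothesis is an invariant: a release trades a free level ahead for an active
    -- request, and a skip loses no free level. When the levels run out, the active requests alone
    -- number at least the target, and capacity forces enough machines; so the target is met however
    -- the loop ends.
    release-outcome : ∀ t j r R → target t ≤ numActive (suc t) (requests R) + numFree t j r →
      Fits g (played (release t j r R)) →
      target t ≤ g * open-bins t (release t j r R) × Outcome t j R (release t j r R)
    release-outcome t j zero R enough fits =
      ≤-trans enough (≤-trans (≤-reflexive (+-identityʳ _)) (active-≤-open-bins t R fits)) , inj₁ refl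
    release-outcome t j (suc r) R enough = choose-elim
      (λ R′ → Fits g (played R′) → target t ≤ g * open-bins t R′ × Outcome t j R R′)
      (even? (block j t)) (target t ≤? g * open-bins t R) skip stop continue
      where
      skip : ¬ Even (block j t) → Fits g (played (release t (suc j) r R)) → _
      skip ¬e fits with release-outcome t (suc j) r R
        (subst (λ k → target t ≤ numActive (suc t) (requests R) + (k + numFree t (suc j) r)) (isEven-no ¬e) enough) fits
      ... | reached , inj₁ eq = reached , inj₁ eq
      ... | reached , inj₂ (o , bound) = reached , inj₂ (o ,
        ≤-trans (+-monoʳ-≤ (extent (release t (suc j) r R)) (^-monoʳ-≤ 2 (n≤1+n (suc j)))) bound)
      stop : Even (block j t) → target t ≤ g * open-bins t R → Fits g (played R) → _
      stop _ reached _ = reached , inj₁ refl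
      R₁ = R ∷ʳ (t , suc j)
      continue : Even (block j t) → ¬ target t ≤ g * open-bins t R → Fits g (played (release t (suc j) r R₁)) → _
      continue e short fits with release-outcome t (suc j) r R₁
        (subst (target t ≤_)
          (trans (cong (λ k → numActive (suc t) (requests R) + (k + numFree t (suc j) r)) (isEven-yes e))
            (trans (+-suc _ _) (cong (_+ numFree t (suc j) r) (sym (numActive-∷ʳ t R (suc j)))))) enough) fits
      -- Nothing follows this request. The target is missed without it and met with it, so it raised
      -- the number of open machines.
      ... | reached , inj₁ eq = reached , inj₂ (record
        { before = R ; level = j ; extends = ⊑-refl ; last-request = eq ; free = e
        ; fresh = fresh-machine t (suc j) R (*-cancelˡ-< g _ _
            (<-≤-trans (≰⇒> short) (subst (λ R′ → target t ≤ g * open-bins t R′) eq reached))) } , (begin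
          extent (release t (suc j) r R₁) + 2 ^ suc j  ≡⟨ cong (λ R′ → extent R′ + 2 ^ suc j) eq ⟩
          extent R₁ + 2 ^ suc j                        ≡⟨ cong (_+ 2 ^ suc j) (extent-∷ʳ R (t , suc j)) ⟩
          extent R + 2 ^ suc j + 2 ^ suc j             ≡⟨ double (extent R) (2 ^ suc j) ⟩
          extent R + 2 * 2 ^ suc j                     ∎))
        where
        open ≤-Reasoning
        double : ∀ a b → a + b + b ≡ a + 2 * b
        double = solve-∀
      ... | reached , inj₂ (o , bound) = reached , inj₂ (record
        { before = Opens.before o ; level = Opens.level o ; extends = ⊑-trans ⊑-∷ʳ (Opens.extends o)
        ; last-request = Opens.last-request o ; free = Opens.free o ; fresh = Opens.fresh o } ,
        -- With `2 ^ suc j` added on both sides, the left becomes that of the induction hypothesis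
        -- one level up, and the right gains the block length of the request just released.
        +-cancelʳ-≤ (2 ^ suc j) _ _ (begin
          extent R′ + 2 ^ suc j + 2 ^ suc j                      ≡⟨ double (extent R′) (2 ^ suc j) ⟩
          extent R′ + 2 ^ suc (suc j)                            ≤⟨ bound ⟩
          extent R₁ + 2 * 2 ^ suc (Opens.level o)                ≡⟨ cong (_+ 2 * 2 ^ suc (Opens.level o)) (extent-∷ʳ R (t , suc j)) ⟩
          extent R + 2 ^ suc j + 2 * 2 ^ suc (Opens.level o)     ≡⟨ swap (extent R) (2 ^ suc j) _ ⟩
          extent R + 2 * 2 ^ suc (Opens.level o) + 2 ^ suc j     ∎))
        where
        open ≤-Reasoning
        R′ = release t (suc j) r R₁
        double : ∀ a b → a + b + b ≡ a + 2 * b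
        double = solve-∀
        swap : ∀ a b c → a + b + c ≡ a + c + b
        swap = solve-∀

  -- The cost of the adversarial steps

  module _ {a r : Level} {A : Set a} {R : ℕ → A → Set r} (R? : ∀ t x → Dec (R t x)) where

    Σ<-indicator : ∀ T x → Σ< T (λ t → length (filter (R? t) (x ∷ []))) ≡ length (filter (λ t → R? t x) (upTo T))
    Σ<-indicator zero x = refl
    Σ<-indicator (suc T) x = begin
      Σ< T (λ t → length (filter (R? t) (x ∷ []))) + length (filter (R? T) (x ∷ []))
        ≡⟨ cong₂ _+_ (Σ<-indicator T x) last ⟩
      length (filter (λ t → R? t x) (upTo T)) + length (filter (λ t → R? t x) (T ∷ []))
        ≡⟨ sym (length-++ (filter (λ t → R? t x) (upTo T))) ⟩
      length (filter (λ t → R? t x) (upTo T) ++ filter (λ t → R? t x) (T ∷ []))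
        ≡⟨ cong length (sym (filter-++ (λ t → R? t x) (upTo T) (T ∷ []))) ⟩
      length (filter (λ t → R? t x) (upTo T ∷ʳ T))
        ≡⟨ cong (length ∘ filter (λ t → R? t x)) (upTo-∷ʳ T) ⟩
      length (filter (λ t → R? t x) (upTo (suc T))) ∎
      where
      open ≡-Reasoning
      last : length (filter (R? T) (x ∷ [])) ≡ length (filter (λ t → R? t x) (T ∷ []))
      last with does (R? T x)
      ... | true = refl
      ... | false = refl

    double-counting : ∀ T xs →
      Σ< T (λ t → length (filter (R? t) xs)) ≡ sum (map (λ x → length (filter (λ t → R? t x) (upTo T))) xs)
    double-counting T [] = trans (Σ<-const T 0) (*-zeroʳ T)
    double-counting T (x ∷ xs) = begin
      Σ< T (λ t → length (filter (R? t) (x ∷ xs)))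
        ≡⟨ Σ<-cong T (λ t _ → trans (cong length (filter-++ (R? t) (x ∷ []) xs)) (length-++ (filter (R? t) (x ∷ [])))) ⟩
      Σ< T (λ t → length (filter (R? t) (x ∷ [])) + length (filter (R? t) xs))
        ≡⟨ Σ<-+ T _ _ ⟩
      Σ< T (λ t → length (filter (R? t) (x ∷ []))) + Σ< T (λ t → length (filter (R? t) xs))
        ≡⟨ cong₂ _+_ (Σ<-indicator T x) (double-counting T xs) ⟩
      _ ∎
      where open ≡-Reasoning

  sum-map-mono : ∀ {a} {A : Set a} {f h : A → ℕ} {xs} → All (λ x → f x ≤ h x) xs → sum (map f xs) ≤ sum (map h xs)
  sum-map-mono [] = z≤n
  sum-map-mono (p ∷ ps) = +-mono-≤ p (sum-map-mono ps)

  Between : ℕ → ℕ → Interval → Set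
  Between lo hi J = lo ≤ start J × end J ≤ hi

  Within : ℕ → Interval → Set
  Within T = Between 1 (suc T)

  sum-durations-≤ : ∀ T Js → All (Within T) Js → sum (map duration Js) ≤ Σ< T (λ t → length (filter (active? (suc t)) Js))
  sum-durations-≤ T Js all = ≤-trans (sum-map-mono (All.map (λ {J} → single {J}) all)) (≤-reflexive (sym (double-counting (λ t → active? (suc t)) T Js)))
    where
    single : ∀ {J} → Within T J → duration J ≤ length (filter (λ t → active? (suc t) J) (upTo T))
    single {J@(interval (suc a) e _)} (_ , e≤) = begin
      duration J                                       ≡⟨ sym (length-applyUpTo (a +_) (duration J)) ⟩
      length (applyUpTo (a +_) (duration J))           ≤⟨ ⊆-length (Unique.applyUpTo⁺₁ (a +_) (duration J) (λ i<j _ eq → <⇒≢ i<j (+-cancelˡ-≡ a _ _ eq))) sub ⟩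
      length (filter (λ t → active? (suc t) J) (upTo T)) ∎
      where
      open ≤-Reasoning
      sub : applyUpTo (a +_) (duration J) ⊆ filter (λ t → active? (suc t) J) (upTo T)
      sub t∈ with ∈-applyUpTo⁻ (a +_) t∈
      ... | i , i<d , refl = ∈-filter⁺ (λ t → active? (suc t) J) (∈-upTo⁺ (≤-pred (≤-trans act e≤))) (s≤s (m≤m+n a i) , act)
        where
        act : suc a + i < e
        act = subst (suc a + i <_) (m+[n∸m]≡n {suc a} {e} (<⇒≤ (m∸n≢0⇒n<m {e} {suc a} (λ eq → n≮0 (subst (i <_) eq i<d))))) (+-monoʳ-< (suc a) i<d)

  Σ<-covering : ∀ T R → Σ< T (λ τ → covering τ R) ≤ extent R
  Σ<-covering T R = ≤-trans (≤-reflexive (double-counting covers? T R)) (sum-map-mono (All.universal single R))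
    where
    single : ∀ x → length (filter (λ τ → covers? τ x) (upTo T)) ≤ 2 ^ proj₂ x
    single x@(t , j) = begin
      length (filter (λ τ → covers? τ x) (upTo T))  ≤⟨ ⊆-length (Unique.filter⁺ (λ τ → covers? τ x) (Unique.upTo⁺ T)) sub ⟩
      length (applyUpTo (a +_) (2 ^ j))             ≡⟨ length-applyUpTo (a +_) (2 ^ j) ⟩
      2 ^ j                                         ∎
      where
      open ≤-Reasoning
      a = block j t * 2 ^ j
      sub : filter (λ τ → covers? τ x) (upTo T) ⊆ applyUpTo (a +_) (2 ^ j)
      sub {τ} τ∈ with ∈-filter⁻ (λ τ → covers? τ x) {xs = upTo T} τ∈
      ... | _ , c = subst (_∈ applyUpTo (a +_) (2 ^ j)) (m+[n∸m]≡n a≤τ)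
        (∈-applyUpTo⁺ (a +_) (+-cancelˡ-< a (τ ∸ a) (2 ^ j) (subst (_< a + 2 ^ j) (sym (m+[n∸m]≡n a≤τ))
          (≤-trans (subst (λ b → τ < suc b * 2 ^ j) c (block-upper j τ)) (≤-reflexive (+-comm (2 ^ j) a))))))
        where
        a≤τ : a ≤ τ
        a≤τ = subst (λ b → b * 2 ^ j ≤ τ) c (block-lower j τ)

  -- Rounding up wastes less than one machine per step, which gives `g * T`; double counting of the
  -- reserved blocks gives the rest.
  packing-bound : ∀ g .{{_ : NonZero g}} T R → g * Σ< T (λ τ → ⌈ covering τ R /⌉ g) ≤ g * T + extent R
  packing-bound g T R = begin
    g * Σ< T (λ τ → ⌈ covering τ R /⌉ g)      ≡⟨ sym (Σ<-*ˡ T g (λ τ → ⌈ covering τ R /⌉ g)) ⟩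
    Σ< T (λ τ → g * ⌈ covering τ R /⌉ g)      ≤⟨ Σ<-mono T (λ τ _ → ⌈/⌉-* (covering τ R) g) ⟩
    Σ< T (λ τ → covering τ R + g)             ≡⟨ Σ<-+ T (λ τ → covering τ R) (λ _ → g) ⟩
    Σ< T (λ τ → covering τ R) + Σ< T (λ _ → g) ≤⟨ +-mono-≤ (Σ<-covering T R) (≤-reflexive (trans (Σ<-const T g) (*-comm T g))) ⟩
    extent R + g * T                          ≡⟨ +-comm (extent R) (g * T) ⟩
    g * T + extent R                          ∎
    where open ≤-Reasoning

  module _ (g : ℕ) {{_ : NonZero g}} where

    item-nonEmpty : ∀ x → start (item g x) < end (item g x)
    item-nonEmpty (t , j) = s≤s (block-upper j t)

    item-duration-≤ : ∀ x → duration (item g x) ≤ 2 ^ proj₂ x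
    item-duration-≤ (t , j) = m≤n+o⇒m∸n≤o (suc (block j t) * 2 ^ j) t
      (≤-trans (+-monoʳ-≤ (2 ^ j) (block-lower j t)) (≤-reflexive (+-comm (2 ^ j) t)))

    -- By evenness `t` is in the left half of its block, so the request runs through the whole right
    -- half, of length `2 ^ i`.
    item-duration-free : ∀ t i → Even (block i t) → 2 ^ i ≤ duration (item g (t , suc i))
    item-duration-free t i e = m+n≤o⇒m≤o∸n (2 ^ i) (begin
      2 ^ i + t                               ≤⟨ +-monoʳ-≤ (2 ^ i) (<⇒≤ (block-upper i t)) ⟩
      2 ^ i + suc (block i t) * 2 ^ i         ≡⟨ cong (λ b → 2 ^ i + suc b * 2 ^ i) (sym e) ⟩
      2 ^ i + suc (2 * c) * 2 ^ i             ≡⟨ rearrange (2 ^ i) c ⟩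
      suc c * (2 * 2 ^ i)                     ∎)
      where
      open ≤-Reasoning
      c = ⌊ block i t /2⌋
      rearrange : ∀ x c → x + suc (2 * c) * x ≡ suc c * (2 * x)
      rearrange = solve-∀

    -- The range is a multiple of `2 ^ L`, so no block of level at most `L` straddles its end.
    item-Within : ∀ M L x → proj₁ x < M * 2 ^ L → proj₂ x ≤ L → Within (M * 2 ^ L) (item g x)
    item-Within M L (t , j) t< j≤L = s≤s z≤n , s≤s (begin
      suc (block j t) * 2 ^ j       ≤⟨ *-monoˡ-≤ (2 ^ j) (*-cancelʳ-< (2 ^ j) (block j t) (M * 2 ^ (L ∸ j))
                                        (≤-<-trans (block-lower j t) (subst (t <_) split t<))) ⟩
      M * 2 ^ (L ∸ j) * 2 ^ j       ≡⟨ sym split ⟩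
      M * 2 ^ L                     ∎)
      where
      open ≤-Reasoning
      split : M * 2 ^ L ≡ M * 2 ^ (L ∸ j) * 2 ^ j
      split = trans (cong (λ k → M * 2 ^ k) (sym (m∸n+n≡m j≤L)))
        (trans (cong (M *_) (^-distribˡ-+-* 2 (L ∸ j) j)) (sym (*-assoc M (2 ^ (L ∸ j)) (2 ^ j))))

  -- Charging the released lengths to the algorithm

  module Analysis (g : ℕ) {{_ : NonZero g}} (ρ : List Interval → Interval → ℕ) (L : ℕ) where
    open Adversary g ρ L

    ≺-raise : ∀ {t j} {x : Label} → x ≺ (t , j) → x ≺ (t , suc j)
    ≺-raise (inj₁ s<t) = inj₁ s<t
    ≺-raise (inj₂ (s≡t , i<j)) = inj₂ (s≡t , m≤n⇒m≤1+n i<j)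

    release-sorted : ∀ t j r R → AllPairs _≺_ R → All (_≺ (t , suc j)) R →
      AllPairs _≺_ (release t j r R) × All (λ x → proj₁ x ≤ t) (release t j r R)
    release-sorted t j zero R sorted all = sorted , All.map (λ { (inj₁ s<t) → <⇒≤ s<t ; (inj₂ (s≡t , _)) → ≤-reflexive s≡t }) all
    release-sorted t j (suc r) R sorted all = choose-elim
      (λ R′ → AllPairs _≺_ R′ × All (λ x → proj₁ x ≤ t) R′) (even? (block j t)) (target t ≤? g * open-bins t R)
      (λ _ → release-sorted t (suc j) r R sorted (All.map ≺-raise all))
      (λ _ _ → release-sorted t j zero R sorted all)
      (λ _ _ → release-sorted t (suc j) r (R ∷ʳ (t , suc j)) (AllPairs-∷ʳ sorted all)
        (All.++⁺ (All.map ≺-raise all) (inj₂ (refl , ≤-refl) ∷ [])))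

    release-levels : ∀ t j r R → j + r ≤ L → All (λ x → proj₂ x ≤ L) R → All (λ x → proj₂ x ≤ L) (release t j r R)
    release-levels t j zero R _ all = all
    release-levels t j (suc r) R j+r≤ all = choose-elim (All (λ x → proj₂ x ≤ L))
      (even? (block j t)) (target t ≤? g * open-bins t R)
      (λ _ → release-levels t (suc j) r R 1+j+r≤ all)
      (λ _ _ → all)
      (λ _ _ → release-levels t (suc j) r (R ∷ʳ (t , suc j)) 1+j+r≤ (All.++⁺ all (≤-trans (m≤m+n (suc j) r) 1+j+r≤ ∷ [])))
      where
      1+j+r≤ : suc j + r ≤ L
      1+j+r≤ = ≤-trans (≤-reflexive (sym (+-suc j r))) j+r≤

    phase-sorted : ∀ n → AllPairs _≺_ (phase n) × All (λ x → proj₁ x < n) (phase n)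
    phase-sorted zero = [] , []
    phase-sorted (suc t) with phase-sorted t
    ... | sorted , times< with release-sorted t 0 L (phase t ∷ʳ (t , 0)) (AllPairs-∷ʳ sorted (All.map inj₁ times<))
      (All.++⁺ (All.map inj₁ times<) (inj₂ (refl , s≤s z≤n) ∷ []))
    ... | sorted′ , times≤ = sorted′ , All.map s≤s times≤

    phase-levels : ∀ n → All (λ x → proj₂ x ≤ L) (phase n)
    phase-levels zero = []
    phase-levels (suc t) = release-levels t 0 L (phase t ∷ʳ (t , 0)) ≤-refl (All.++⁺ (phase-levels t) (z≤n ∷ []))

    phase-Unique : ∀ n → Unique (phase n)
    phase-Unique n = AllPairs.map ≺⇒≢ (proj₁ (phase-sorted n))

    phase-⊑-≤ : ∀ {m n} → m ≤ n → phase m ⊑ phase n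
    phase-⊑-≤ {m} {n} m≤n = subst (λ k → phase m ⊑ phase k) (m∸n+n≡m m≤n) (phase-⊑ m (n ∸ m))

    unit-∈-phase : ∀ {t n} → t < n → (t , 0) ∈ phase n
    unit-∈-phase {t} t<n = ⊑⇒⊆ (⊑-trans (release-⊑ t 0 L (phase t ∷ʳ (t , 0))) (phase-⊑-≤ t<n)) (∈-++⁺ʳ (phase t) (here refl))

    step-outcome : ∀ t → Fits g (played (phase (suc t))) →
      target t ≤ g * open-bins t (phase (suc t)) × Outcome t 0 (phase t ∷ʳ (t , 0)) (phase (suc t))
    step-outcome t = release-outcome t 0 L (phase t ∷ʳ (t , 0)) (m≤n+m (target t) _)

    requests-⊆ : ∀ {R S} → R ⊑ S → requests R ⊆ requests S
    requests-⊆ {R} (zs , refl) J∈ = subst (_ ∈_) (sym (map-++ (item g) R zs)) (∈-++⁺ˡ J∈)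

    -- The requests that opened a machine as the last request of their step: those active at one time sit on distinct machines.
    record Openers (n : ℕ) : Set where
      field
        openers  : List Placed
        machines : ∀ s → on s openers ⊆ on s (played (phase n))
        unique   : ∀ s → Unique (on s openers)
        origin   : All (λ p → proj₁ p ∈ requests (phase n)) openers
        extent≤  : extent (phase n) ≤ n + 4 * sum (map duration (map proj₁ openers))

    openers-exist : ∀ n → Fits g (played (phase n)) → Openers n
    openers-exist zero fits = record { openers = [] ; machines = λ s () ; unique = λ s → [] ; origin = [] ; extent≤ = z≤n }
    openers-exist (suc t) fits with openers-exist t (Fits-⊑ (phase-⊑-suc t) fits) | step-outcome t fits
    ... | O | _ , inj₁ eq = record
      { openers = openers
      ; machines = λ s → on-played-mono s (phase-⊑-suc t) ∘ machines s
      ; unique = unique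
      ; origin = All.map (requests-⊆ (phase-⊑-suc t)) origin
      ; extent≤ = begin
          extent (phase (suc t))       ≡⟨ cong extent eq ⟩
          extent (phase t ∷ʳ (t , 0))  ≡⟨ extent-∷ʳ (phase t) (t , 0) ⟩
          extent (phase t) + 1         ≤⟨ +-monoˡ-≤ 1 extent≤ ⟩
          t + 4 * D + 1                ≡⟨ +-comm (t + 4 * D) 1 ⟩
          suc t + 4 * D                ∎
      }
      where
      open Openers O
      open ≤-Reasoning
      D : ℕ
      D = sum (map duration (map proj₁ openers))
    ... | O | _ , inj₂ (o , bound) = record
      { openers = openers ∷ʳ new
      ; machines = λ s m∈ → [ on-played-mono s (phase-⊑-suc t) ∘ machines s , on-new s ]′
          (∈-++⁻ (on s openers) (subst (_ ∈_) (on-++ s openers (new ∷ [])) m∈))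
      ; unique = λ s → subst Unique (sym (on-++ s openers (new ∷ []))) (unique-new s (active? s J))
      ; origin = All.++⁺ (All.map (requests-⊆ (phase-⊑-suc t)) origin)
          (subst (λ R → J ∈ requests R) (sym last-request) (∈-map⁺ (item g) (∈-++⁺ʳ before (here refl))) ∷ [])
      ; extent≤ = begin
          extent (phase (suc t))                                 ≤⟨ m+n≤o⇒m≤o (extent (phase (suc t))) bound ⟩
          extent (phase t ∷ʳ (t , 0)) + 2 * 2 ^ suc level        ≡⟨ cong (_+ 2 * 2 ^ suc level) (extent-∷ʳ (phase t) (t , 0)) ⟩
          extent (phase t) + 1 + 2 * 2 ^ suc level               ≤⟨ +-monoˡ-≤ _ (+-monoˡ-≤ 1 extent≤) ⟩
          -- The factor 4: the geometric series costs twice the block of the last request, and that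
          -- block is at most twice its duration. The unit request accounts for the growth of `t` to
          -- `suc t`.
          t + 4 * D + 1 + 2 * (2 * 2 ^ level)                    ≡⟨ rearrange t D (2 ^ level) ⟩
          suc t + 4 * (D + 2 ^ level)                            ≤⟨ +-monoʳ-≤ (suc t) (*-monoʳ-≤ 4 (+-monoʳ-≤ D (item-duration-free g t level free))) ⟩
          suc t + 4 * (D + duration J)                           ≡⟨ cong (λ d → suc t + 4 * d) (sym durations-∷ʳ) ⟩
          suc t + 4 * sum (map duration (map proj₁ (openers ∷ʳ new))) ∎
      }
      where
      open Openers O
      open Opens o
      open ≤-Reasoning hiding (start)
      J : Interval
      J = item g (t , suc level)
      m : ℕ
      m = ρ (requests before) J
      new : Placed
      new = J , m
      D : ℕ
      D = sum (map duration (map proj₁ openers))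
      durations-∷ʳ : sum (map duration (map proj₁ (openers ∷ʳ new))) ≡ D + duration J
      durations-∷ʳ = trans (cong (sum ∘ map duration) (map-++ proj₁ openers _))
        (trans (cong sum (map-++ duration (map proj₁ openers) _)) (trans (sum-++ (map duration (map proj₁ openers)) _) (cong (D +_) (+-identityʳ _))))
      rearrange : ∀ t D x → t + 4 * D + 1 + 2 * (2 * x) ≡ suc t + 4 * (D + x)
      rearrange = solve-∀
      before-played : phase t ⊑ before
      before-played = ⊑-trans ⊑-∷ʳ extends
      on-new : ∀ s → on s (new ∷ []) ⊆ on s (played (phase (suc t)))
      on-new s {k} k∈ = subst (λ pl → k ∈ on s pl) (sym (trans (cong played last-request) (played-∷ʳ before (t , suc level))))
        (subst (k ∈_) (sym (on-++ s (played before) (new ∷ []))) (∈-++⁺ʳ (on s (played before)) k∈))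
      -- An earlier opener active together with `J` started in an earlier step, so it already ran at
      -- the arrival time `suc t`. Its machine was then open and differs from the fresh one.
      fresh-at : ∀ {s} → Active s J → m ∉ on s openers
      fresh-at {s} (t<s , _) m∈ with ∈-map⁻ proj₂ m∈
      ... | p , p∈ , m≡ with ∈-filter⁻ (active? s ∘ proj₁) {xs = openers} p∈
      ... | p∈O , (_ , s<end) with ∈-map⁻ (item g) (All.lookup origin p∈O)
      ... | x , x∈ , p≡ = fresh (on-played-mono (suc t) before-played (machines (suc t)
        (subst (_∈ on (suc t) openers) (sym m≡) (∈-map⁺ proj₂ (∈-filter⁺ (active? (suc t) ∘ proj₁) p∈O (started , ≤-<-trans t<s s<end))))))
        where
        started : start (proj₁ p) ≤ suc t
        started = subst (λ K → start K ≤ suc t) (sym p≡) (s≤s (<⇒≤ (All.lookup (proj₂ (phase-sorted t)) x∈)))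
      unique-new : ∀ s → Dec (Active s J) → Unique (on s openers ++ on s (new ∷ []))
      unique-new s (yes act) = subst (λ ms → Unique (on s openers ++ ms))
        (sym (cong (map proj₂) (filter-all (active? s ∘ proj₁) {xs = new ∷ []} (act ∷ []))))
        (AllPairs-∷ʳ (unique s) (All.tabulate λ k∈ k≡m → fresh-at act (subst (_∈ on s openers) k≡m k∈)))
      unique-new s (no ¬act) = subst Unique
        (sym (trans (cong (λ ms → on s openers ++ map proj₂ ms) (filter-none (active? s ∘ proj₁) {xs = new ∷ []} (¬act ∷ []))) (++-identityʳ _)))
        (unique s)

    phase-Within : ∀ M → All (Within (M * 2 ^ L)) (requests (phase (M * 2 ^ L)))
    phase-Within M = All.map⁺ (All.zipWith (λ { {x} (t< , j≤) → item-Within g M L x t< j≤ }) (proj₂ (phase-sorted (M * 2 ^ L)) , phase-levels (M * 2 ^ L)))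

    module _ (M : ℕ) (fits : Fits g (played (phase (M * 2 ^ L)))) where
      private
        T : ℕ
        T = M * 2 ^ L

      phaseCost : ℕ
      phaseCost = Σ< T (λ t → open-bins t (phase T))

      phase-levels-bound : L * T ≤ 2 * (g * phaseCost)
      phase-levels-bound = begin
        L * T                                       ≡⟨ sym (Σ<-numFree M 0 L) ⟩
        2 * Σ< T target                             ≤⟨ *-monoʳ-≤ 2 (Σ<-mono T reached) ⟩
        2 * Σ< T (λ t → g * open-bins t (phase T))  ≡⟨ cong (2 *_) (Σ<-*ˡ T g (λ t → open-bins t (phase T))) ⟩
        2 * (g * phaseCost)                         ∎
        where
        open ≤-Reasoning
        reached : ∀ t → t < T → target t ≤ g * open-bins t (phase T)
        reached t t<T = ≤-trans (proj₁ (step-outcome t (Fits-⊑ (phase-⊑-≤ t<T) fits))) (*-monoʳ-≤ g (open-bins-mono t (phase-⊑-≤ t<T)))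

      phase-extent-bound : extent (phase T) ≤ T + 4 * phaseCost
      phase-extent-bound = ≤-trans extent≤ (+-monoʳ-≤ T (*-monoʳ-≤ 4 (begin
        sum (map duration (map proj₁ openers))
          ≤⟨ sum-durations-≤ T (map proj₁ openers) (All.map⁺ (All.map (All.lookup (phase-Within M)) origin)) ⟩
        Σ< T (λ t → length (filter (active? (suc t)) (map proj₁ openers)))
          ≡⟨ Σ<-cong T (λ t _ → sym (length-on (suc t) openers)) ⟩
        Σ< T (λ t → length (on (suc t) openers))
          ≤⟨ Σ<-mono T (λ t _ → unique-⊆-distinct (unique (suc t)) (machines (suc t))) ⟩
        phaseCost ∎)))
        where
        open ≤-Reasoning
        open Openers (openers-exist T fits)

      phase-packing-bound : g * Σ< T (λ τ → ⌈ covering τ (phase T) /⌉ g) ≤ 2 * (g * T) + 4 * phaseCost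
      phase-packing-bound = begin
        g * Σ< T (λ τ → ⌈ covering τ (phase T) /⌉ g)  ≤⟨ packing-bound g T (phase T) ⟩
        g * T + extent (phase T)                      ≤⟨ +-monoʳ-≤ (g * T) phase-extent-bound ⟩
        g * T + (T + 4 * phaseCost)                   ≤⟨ +-monoʳ-≤ (g * T) (+-monoˡ-≤ _ (m≤n*m T g)) ⟩
        g * T + (g * T + 4 * phaseCost)               ≡⟨ rearrange (g * T) (4 * phaseCost) ⟩
        2 * (g * T) + 4 * phaseCost                   ∎
        where
        open ≤-Reasoning
        rearrange : ∀ x y → x + (x + y) ≡ 2 * x + y
        rearrange = solve-∀

  -- Padding to the prescribed average load

  on-accept : ∀ {t} p pl → Active t (proj₁ p) → on t (p ∷ pl) ≡ proj₂ p ∷ on t pl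
  on-accept {t} p pl act = cong (map proj₂) (filter-accept (active? t ∘ proj₁) {p} {pl} act)

  on-reject : ∀ {t} p pl → ¬ Active t (proj₁ p) → on t (p ∷ pl) ≡ on t pl
  on-reject {t} p pl ¬act = cong (map proj₂) (filter-reject (active? t ∘ proj₁) {p} {pl} ¬act)

  Between-widen : ∀ {lo lo′ hi hi′ J} → lo′ ≤ lo → hi ≤ hi′ → Between lo hi J → Between lo′ hi′ J
  Between-widen lo≤ hi≤ (l , h) = ≤-trans lo≤ l , ≤-trans h hi≤

  on-before : ∀ {lo hi t} pl → All (Between lo hi) (map proj₁ pl) → t < lo → on t pl ≡ []
  on-before pl all t<lo = on-∅ pl (All.map (λ { (l , _) (s , _) → <⇒≱ t<lo (≤-trans l s) }) (All.map⁻ all))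

  on-after : ∀ {lo hi t} pl → All (Between lo hi) (map proj₁ pl) → hi ≤ t → on t pl ≡ []
  on-after pl all hi≤t = on-∅ pl (All.map (λ { (_ , h) (_ , e) → <⇒≱ e (≤-trans h hi≤t) }) (All.map⁻ all))

  module _ {lo mid hi : ℕ} (xs ys : List Placed) (before : All (Between lo mid) (map proj₁ xs)) (after : All (Between mid hi) (map proj₁ ys)) where

    on-++ˡ : ∀ {t} → t < mid → on t (xs ++ ys) ≡ on t xs
    on-++ˡ {t} t<mid = trans (on-++ t xs ys) (trans (cong (on t xs ++_) (on-before ys after t<mid)) (++-identityʳ (on t xs)))

    on-++ʳ : ∀ {t} → mid ≤ t → on t (xs ++ ys) ≡ on t ys
    on-++ʳ {t} mid≤t = trans (on-++ t xs ys) (cong (_++ on t ys) (on-after xs before mid≤t))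

    Fits-++⁺ : ∀ {g} → Fits g xs → Fits g ys → Fits g (xs ++ ys)
    Fits-++⁺ {g} fx fy m t with t <? mid
    ... | yes t<mid = subst (λ ms → count m ms ≤ g) (sym (on-++ˡ t<mid)) (fx m t)
    ... | no t≮mid = subst (λ ms → count m ms ≤ g) (sym (on-++ʳ (≮⇒≥ t≮mid))) (fy m t)

  StartsBefore : Interval → Interval → Set
  StartsBefore J K = start J ≤ start K

  NonEmpty : Interval → Set
  NonEmpty J = start J < end J

  StartsBefore-++⁺ : ∀ {lo mid hi xs ys} → All (Between lo mid) xs → All NonEmpty xs → All (Between mid hi) ys →
    AllPairs StartsBefore xs → AllPairs StartsBefore ys → AllPairs StartsBefore (xs ++ ys)
  StartsBefore-++⁺ before nonEmpty after sx sy = AllPairs.++⁺ sx sy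
    (All.zipWith (λ { ((_ , h) , ne) → All.map (λ { (l , _) → ≤-trans (<⇒≤ ne) (≤-trans h l) }) after }) (before , nonEmpty))

  module _ (g : ℕ) {{_ : NonZero g}} where

    chain : ℕ → List ℕ → List Interval
    chain a [] = []
    chain a (d ∷ ds) = interval a (a + d) (1 /ₙ g) ∷ chain (a + d) ds

    chain-Between : ∀ a ds → All (Between a (a + sum ds)) (chain a ds)
    chain-Between a [] = []
    chain-Between a (d ∷ ds) = (≤-refl , +-monoʳ-≤ a (m≤m+n d (sum ds))) ∷
      All.map (λ {J} → Between-widen {J = J} (m≤m+n a d) (≤-reflexive (+-assoc a d (sum ds)))) (chain-Between (a + d) ds)

    chain-NonEmpty : ∀ a ds → All (0 <_) ds → All NonEmpty (chain a ds)
    chain-NonEmpty a [] [] = []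
    chain-NonEmpty a (d ∷ ds) (p ∷ ps) = m<m+n a p ∷ chain-NonEmpty (a + d) ds ps

    chain-sorted : ∀ a ds → AllPairs StartsBefore (chain a ds)
    chain-sorted a [] = []
    chain-sorted a (d ∷ ds) = All.map (λ { (l , _) → ≤-trans (m≤m+n a d) l }) (chain-Between (a + d) ds) ∷ chain-sorted (a + d) ds

    chain-sizes : ∀ a ds → All (λ J → size J ≡ 1 /ₙ g) (chain a ds)
    chain-sizes a [] = []
    chain-sizes a (d ∷ ds) = refl ∷ chain-sizes (a + d) ds

    chain-durations : ∀ a ds → map duration (chain a ds) ≡ ds
    chain-durations a [] = refl
    chain-durations a (d ∷ ds) = cong₂ _∷_ (m+n∸m≡n a d) (chain-durations (a + d) ds)

    onMachine0 : List Interval → List Placed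
    onMachine0 = map (_, 0)

    map-proj₁-onMachine0 : ∀ Js → map proj₁ (onMachine0 Js) ≡ Js
    map-proj₁-onMachine0 Js = trans (sym (map-∘ Js)) (map-id Js)

    on-chain : ∀ {t} a ds → a ≤ t → t < a + sum ds → on t (onMachine0 (chain a ds)) ≡ 0 ∷ []
    on-chain {t} a [] a≤t t< = ⊥-elim (<⇒≱ t< (≤-trans (≤-reflexive (+-identityʳ a)) a≤t))
    on-chain {t} a (d ∷ ds) a≤t t< = step (t <? a + d)
      where
      first = interval a (a + d) (1 /ₙ g)
      rest = onMachine0 (chain (a + d) ds)
      step : Dec (t < a + d) → on t ((first , 0) ∷ rest) ≡ 0 ∷ []
      step (yes t<a+d) = trans (on-accept {t} (first , 0) rest (a≤t , t<a+d))
        (cong (0 ∷_) (on-before rest (subst (All _) (sym (map-proj₁-onMachine0 (chain (a + d) ds))) (chain-Between (a + d) ds)) t<a+d))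
      step (no t≮a+d) = trans (on-reject {t} (first , 0) rest (λ { (_ , t<a+d) → t≮a+d t<a+d }))
        (on-chain (a + d) ds (≮⇒≥ t≮a+d) (subst (t <_) (sym (+-assoc a d (sum ds))) t<))

    chain-active : ∀ {t} a ds → a ≤ t → t < a + sum ds → Any (Active t) (chain a ds)
    chain-active a [] a≤t t< = ⊥-elim (<⇒≱ t< (≤-trans (≤-reflexive (+-identityʳ a)) a≤t))
    chain-active {t} a (d ∷ ds) a≤t t< with t <? a + d
    ... | yes t<a+d = here (a≤t , t<a+d)
    ... | no t≮a+d = there (chain-active (a + d) ds (≮⇒≥ t≮a+d) (subst (t <_) (sym (+-assoc a d (sum ds))) t<))

    Fits-chain : ∀ a ds → Fits g (onMachine0 (chain a ds))
    Fits-chain a ds m t = bound (t <? a) (t <? a + sum ds)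
      where
      between = subst (All _) (sym (map-proj₁-onMachine0 (chain a ds))) (chain-Between a ds)
      bound : Dec (t < a) → Dec (t < a + sum ds) → count m (on t (onMachine0 (chain a ds))) ≤ g
      bound (yes t<a) _ = subst (λ ms → count m ms ≤ g) (sym (on-before _ between t<a)) z≤n
      bound (no t≮a) (yes t<) = subst (λ ms → count m ms ≤ g) (sym (on-chain a ds (≮⇒≥ t≮a) t<))
        (≤-trans (length-filter (_≟ m) (0 ∷ [])) (ℕ.>-nonZero⁻¹ g))
      bound (no _) (no t≮) = subst (λ ms → count m ms ≤ g) (sym (on-after _ between (≮⇒≥ t≮))) z≤n

    stack : ℕ → ℕ → List Placed
    stack a n = applyUpTo (λ i → interval a (suc a) (1 /ₙ g) , i / g) n

    on-stack : ∀ a n → on a (stack a n) ≡ map (_/ g) (upTo n)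
    on-stack a n = begin
      on a (stack a n)          ≡⟨ cong (map proj₂) (filter-all (active? a ∘ proj₁) (All.applyUpTo⁺₂ _ n (λ _ → ≤-refl , ≤-refl))) ⟩
      map proj₂ (stack a n)     ≡⟨ map-applyUpTo _ proj₂ n ⟩
      applyUpTo (_/ g) n        ≡⟨ sym (map-upTo (_/ g) n) ⟩
      map (_/ g) (upTo n)       ∎
      where open ≡-Reasoning

    bins-stack : ∀ a X → bins a (stack a (g * X)) ≤ X
    bins-stack a X = subst (λ ms → distinct ms ≤ X) (sym (on-stack a (g * X)))
      (distinct-< (All.map⁺ (All.applyUpTo⁺₁ id (g * X) (λ {i} i< → m<n*o⇒m/o<n (subst (i <_) (*-comm g X) i<)))))

    stack-Between : ∀ a n → All (Between a (suc a)) (map proj₁ (stack a n))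
    stack-Between a n = All.map⁺ (All.applyUpTo⁺₂ _ n (λ _ → ≤-refl , ≤-refl))

    Fits-stack : ∀ a n → Fits g (stack a n)
    Fits-stack a n m t with <-cmp t a
    ... | tri< t<a _ _ = subst (λ ms → count m ms ≤ g) (sym (on-before (stack a n) (stack-Between a n) t<a)) z≤n
    ... | tri≈ _ refl _ = subst (λ ms → count m ms ≤ g) (sym (on-stack a n)) (count-quotients g m (upTo n) (Unique.upTo⁺ n))
    ... | tri> _ _ a<t = subst (λ ms → count m ms ≤ g) (sym (on-after (stack a n) (stack-Between a n) a<t)) z≤n

  schedule-exists : ∀ I pl → map proj₁ pl ≡ intervals I → ∃[ σ ] placed I σ ≡ pl
  schedule-exists I pl eq = (λ i → nth (map proj₂ pl) (toℕ i)) , trans (map-tabulate id _) (go pl (intervals I) eq)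
    where
    go : ∀ pl Js → map proj₁ pl ≡ Js → tabulate (λ i → lookup Js i , nth (map proj₂ pl) (toℕ i)) ≡ pl
    go [] [] _ = refl
    go (p ∷ pl) (J ∷ Js) refl = cong (p ∷_) (go pl Js refl)

  schedule-from : ∀ I g .{{_ : NonZero g}} → All (λ J → size J ≡ 1 /ₙ g) (intervals I) →
    ∀ pl → map proj₁ pl ≡ intervals I → Fits g pl →
    ∃[ σ ] Feasible I σ × cost I σ ≡ Σ< (horizon I) (λ t → bins (suc t) pl)
  schedule-from I g sizes≡ pl eq fits with schedule-exists I pl eq
  ... | σ , refl = σ , Fits⇒Feasible I σ g sizes≡ fits , cost-placed I σ

  -- The interface between padding and estimate. The load is given exactly, because the average must
  -- equal v; for OPT an upper bound on some feasible cost suffices.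
  record PaddedInstance (g : ℕ) {{_ : NonZero g}} (T : ℕ) (core : List Interval) (μ k X : ℕ) : Set where
    field
      I            : Instance
      sizes≡       : All (λ J → size J ≡ 1 /ₙ g) (intervals I)
      rest         : List Interval
      intervals≡   : intervals I ≡ core ++ rest
      horizon≡     : horizon I ≡ T + suc (μ + k)
      maxDuration≡ : maxDuration I ≡ μ
      load≡        : Σ< (horizon I) (λ t → ⌈ numActive (suc t) (intervals I) /⌉ g) ≡
                     Σ< T (λ t → ⌈ numActive (suc t) core /⌉ g) + ((μ + k) + X)
      schedulable  : ∀ pl → map proj₁ pl ≡ core → Fits g pl →
                     ∃[ σ ] Feasible I σ × cost I σ ≤ Σ< T (λ t → bins (suc t) pl) + ((μ + k) + X)

  -- A core on the times 1, …, T is followed by one request of length μ, k unit requests in succession, and a final step carrying load X.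
  module Padding (g : ℕ) {{_ : NonZero g}} (T : ℕ) (core : List Interval)
    (sorted : AllPairs StartsBefore core) (nonEmpties : All NonEmpty core) (within : All (Within T) core)
    (core-sizes : All (λ J → size J ≡ 1 /ₙ g) core) (busy : ∀ t → t < T → Any (Active (suc t)) core)
    (μ : ℕ) (1≤μ : 1 ≤ μ) (durations≤μ : All (λ J → duration J ≤ μ) core) (k X : ℕ) (1≤X : 1 ≤ X) where

    -- The first entry makes the maximum duration exactly `μ`, a length that the core need not
    -- contain.
    lengths : List ℕ
    lengths = μ ∷ replicate k 1

    sum-lengths : sum lengths ≡ μ + k
    sum-lengths = cong (μ +_) (ones k)
      where
      ones : ∀ k → sum (replicate k 1) ≡ k
      ones zero = refl
      ones (suc k) = cong suc (ones k)

    D last : ℕ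
    D = sum lengths
    last = suc T + D

    middle final : List Placed
    middle = onMachine0 g (chain g (suc T) lengths)
    final = stack g last (g * X)

    tail : List Interval
    tail = map proj₁ middle ++ map proj₁ final

    middle≡ : map proj₁ middle ≡ chain g (suc T) lengths
    middle≡ = map-proj₁-onMachine0 g (chain g (suc T) lengths)

    onMiddle : ∀ {p} {P : Interval → Set p} → All P (chain g (suc T) lengths) → All P (map proj₁ middle)
    onMiddle = subst (All _) (sym middle≡)

    onFinal : ∀ {p} {P : Interval → Set p} → P (interval last (suc last) (1 /ₙ g)) → All P (map proj₁ final)
    onFinal pJ = All.map⁺ (All.applyUpTo⁺₂ _ (g * X) (λ _ → pJ))

    g*X>0 : 0 < g * X
    g*X>0 = *-mono-≤ (ℕ.>-nonZero⁻¹ g) 1≤X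

    inFinal : ∀ {p} {P : Interval → Set p} → P (interval last (suc last) (1 /ₙ g)) → Any P (map proj₁ final)
    inFinal pJ = Any.map⁺ (Any.applyUpTo⁺ _ {0} pJ g*X>0)

    middle-Between : All (Between (suc T) last) (map proj₁ middle)
    middle-Between = onMiddle (chain-Between g (suc T) lengths)

    final-Between : All (Between last (suc last)) (map proj₁ final)
    final-Between = onFinal (≤-refl , ≤-refl)

    suc-T≤last : suc T ≤ last
    suc-T≤last = m≤m+n (suc T) D

    tail-Between : All (Between (suc T) (suc last)) tail
    tail-Between = All.++⁺ (All.map (λ {J} → Between-widen {J = J} ≤-refl (n≤1+n last)) middle-Between)
      (All.map (λ {J} → Between-widen {J = J} suc-T≤last ≤-refl) final-Between)

    requested : List Interval
    requested = core ++ tail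

    all-requested : ∀ {p} {P : Interval → Set p} → All P core → All P (chain g (suc T) lengths) →
      P (interval last (suc last) (1 /ₙ g)) → All P requested
    all-requested c m f = All.++⁺ c (All.++⁺ (onMiddle m) (onFinal f))

    requested-sizes : All (λ J → size J ≡ 1 /ₙ g) requested
    requested-sizes = all-requested core-sizes (chain-sizes g (suc T) lengths) refl

    lengths>0 : All (0 <_) lengths
    lengths>0 = 1≤μ ∷ All.replicate⁺ k ≤-refl

    padded : Instance
    padded = record
      { horizon = last
      ; intervals = requested
      ; arrivalOrder = Linked.AllPairs⇒Linked (StartsBefore-++⁺ within nonEmpties tail-Between sorted
          (StartsBefore-++⁺ middle-Between (onMiddle (chain-NonEmpty g (suc T) lengths lengths>0)) final-Between
            (subst (AllPairs StartsBefore) (sym middle≡) (chain-sorted g (suc T) lengths))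
            (AllPairs.map⁺ (AllPairs.applyUpTo⁺₂ _ (g * X) (λ _ _ → ≤-refl)))))
      ; nonEmpty = all-requested nonEmpties (chain-NonEmpty g (suc T) lengths lengths>0) ≤-refl
      ; inHorizon = All.++⁺ (All.map (λ {J} → Between-widen {J = J} ≤-refl (≤-trans suc-T≤last (n≤1+n last))) within)
          (All.map (λ {J} → Between-widen {J = J} (s≤s z≤n) ≤-refl) tail-Between)
      ; sizes = All.map (λ { {J} refl → ℚ.positive⁻¹ (1 /ₙ g) {{ℚ.normalize-pos 1 g}} ,
          /ₙ-≤ {1} {g} {1} {1} (≤-trans (ℕ.>-nonZero⁻¹ g) (≤-reflexive (sym (*-identityˡ g)))) }) requested-sizes
      ; neverIdle = neverIdle′
      -- The final step supplies a request of duration 1 even when the core is empty and `k` is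
      -- zero; this is one use of `1≤X`.
      ; unit-duration = Any.++⁺ʳ core (Any.++⁺ʳ (map proj₁ middle) (inFinal {P = λ J → duration J ≡ 1} (m+n∸n≡m 1 last)))
      }
      where
      neverIdle′ : ∀ t → 1 ≤ t → t ≤ last → Any (Active t) requested
      neverIdle′ (suc t) _ t≤ with t <? T
      ... | yes t<T = Any.++⁺ˡ (busy t t<T)
      ... | no t≮T with suc t <? last
      ...   | yes t<last = Any.++⁺ʳ core (Any.++⁺ˡ (subst (Any (Active (suc t))) (sym middle≡) (chain-active g (suc T) lengths (s≤s (≮⇒≥ t≮T)) t<last)))
      ...   | no t≮last = Any.++⁺ʳ core (Any.++⁺ʳ (map proj₁ middle) (inFinal (≮⇒≥ t≮last , s≤s t≤)))

    padded-maxDuration : maxDuration padded ≡ μ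
    padded-maxDuration = max≈v⁺ (subst (_∈ map duration requested) (m+n∸m≡n (suc T) μ) (∈-map⁺ duration longest))
      (All.map⁺ (all-requested durations≤μ
        (All.map⁻ (subst (All (_≤ μ)) (sym (chain-durations g (suc T) lengths)) (≤-refl ∷ All.replicate⁺ k 1≤μ)))
        (≤-trans (≤-reflexive (m+n∸n≡m 1 last)) 1≤μ)))
      z≤n
      where
      longest : interval (suc T) (suc T + μ) (1 /ₙ g) ∈ requested
      longest = ∈-++⁺ʳ core (∈-++⁺ˡ (subst (interval (suc T) (suc T + μ) (1 /ₙ g) ∈_) (sym middle≡) (here refl)))

    Σ<-last : ∀ f → Σ< last f ≡ Σ< T f + (Σ< D (λ i → f (T + i)) + f (T + D))
    Σ<-last f = trans (cong (_+ f (T + D)) (Σ<-split T D f)) (+-assoc (Σ< T f) _ _)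

    module _ (corePlaced : List Placed) (core≡ : map proj₁ corePlaced ≡ core) where

      assembled : List Placed
      assembled = corePlaced ++ middle ++ final

      tail≡ : map proj₁ (middle ++ final) ≡ tail
      tail≡ = map-++ proj₁ middle final

      assembled≡ : map proj₁ assembled ≡ requested
      assembled≡ = trans (map-++ proj₁ corePlaced (middle ++ final)) (cong₂ _++_ core≡ tail≡)

      core-Between : All (Between 1 (suc T)) (map proj₁ corePlaced)
      core-Between = subst (All _) (sym core≡) within

      tail-Between′ : All (Between (suc T) (suc last)) (map proj₁ (middle ++ final))
      tail-Between′ = subst (All _) (sym tail≡) tail-Between

      on-core : ∀ {t} → t < T → on (suc t) assembled ≡ on (suc t) corePlaced
      on-core t<T = on-++ˡ corePlaced (middle ++ final) core-Between tail-Between′ (s≤s t<T)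

      on-middle : ∀ {i} → i < D → on (suc (T + i)) assembled ≡ 0 ∷ []
      on-middle {i} i<D = trans (on-++ʳ corePlaced (middle ++ final) core-Between tail-Between′ (s≤s (m≤m+n T i)))
        (trans (on-++ˡ middle final middle-Between final-Between (s≤s (+-monoʳ-< T i<D)))
          (on-chain g (suc T) lengths (s≤s (m≤m+n T i)) (s≤s (+-monoʳ-< T i<D))))

      on-final : on last assembled ≡ map (_/ g) (upTo (g * X))
      on-final = trans (on-++ʳ corePlaced (middle ++ final) core-Between tail-Between′ suc-T≤last)
        (trans (on-++ʳ middle final middle-Between final-Between ≤-refl) (on-stack g last (g * X)))

      assembled-cost : Σ< last (λ t → bins (suc t) assembled) ≤ Σ< T (λ t → bins (suc t) corePlaced) + (D + X)
      assembled-cost = begin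
        Σ< last (λ t → bins (suc t) assembled)
          ≡⟨ Σ<-last (λ t → bins (suc t) assembled) ⟩
        Σ< T (λ t → bins (suc t) assembled) + (Σ< D (λ i → bins (suc (T + i)) assembled) + bins last assembled)
          ≤⟨ +-mono-≤ (≤-reflexive (Σ<-cong T (λ t t<T → cong distinct (on-core t<T))))
               (+-mono-≤ (≤-reflexive (trans (Σ<-cong D (λ i i<D → cong distinct (on-middle i<D))) (trans (Σ<-const D 1) (*-identityʳ D))))
                 (subst (λ ms → distinct ms ≤ X) (trans (on-stack g last (g * X)) (sym on-final)) (bins-stack g last X))) ⟩
        Σ< T (λ t → bins (suc t) corePlaced) + (D + X) ∎
        where open ≤-Reasoning

      assembled-Fits : Fits g corePlaced → Fits g assembled
      assembled-Fits fits = Fits-++⁺ corePlaced (middle ++ final) core-Between tail-Between′ fits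
        (Fits-++⁺ middle final middle-Between final-Between (Fits-chain g (suc T) lengths) (Fits-stack g last (g * X)))

      schedule-padded : Fits g corePlaced →
        ∃[ σ ] Feasible padded σ × cost padded σ ≤ Σ< T (λ t → bins (suc t) corePlaced) + (D + X)
      schedule-padded fits =
        let σ , feas , cost≡ = schedule-from padded g requested-sizes assembled assembled≡ (assembled-Fits fits)
        in σ , feas , ≤-trans (≤-reflexive cost≡) assembled-cost

    padded-load : Σ< last (λ t → ⌈ numActive (suc t) requested /⌉ g) ≡ Σ< T (λ t → ⌈ numActive (suc t) core /⌉ g) + (D + X)
    padded-load = begin
      Σ< last load  ≡⟨ Σ<-last load ⟩
      Σ< T load + (Σ< D (λ i → load (T + i)) + load (T + D))
        ≡⟨ cong₂ _+_ (Σ<-cong T (λ t t<T → cong (λ n → ⌈ n /⌉ g) (core-load t<T)))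
             (cong₂ _+_ (trans (Σ<-cong D (λ i i<D → trans (cong (λ n → ⌈ n /⌉ g) (middle-load i<D)) (⌈1/⌉ g))) (trans (Σ<-const D 1) (*-identityʳ D)))
               (trans (cong (λ n → ⌈ n /⌉ g) final-load) (⌈/⌉-exact X g))) ⟩
      Σ< T (λ t → ⌈ numActive (suc t) core /⌉ g) + (D + X) ∎
      where
      open ≡-Reasoning
      load : ℕ → ℕ
      load t = ⌈ numActive (suc t) requested /⌉ g
      -- Loads do not depend on the placement, so an arbitrary one lets the facts about placed lists
      -- compute them.
      cp = onMachine0 g core
      cp≡ = map-proj₁-onMachine0 g core
      numActive-on : ∀ t → numActive t requested ≡ length (on t (assembled cp cp≡))
      numActive-on t = sym (trans (length-on t (assembled cp cp≡)) (cong (numActive t) (assembled≡ cp cp≡)))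
      core-load : ∀ {t} → t < T → numActive (suc t) requested ≡ numActive (suc t) core
      core-load {t} t<T = trans (numActive-on (suc t)) (trans (cong length (on-core cp cp≡ t<T)) (trans (length-on (suc t) cp) (cong (numActive (suc t)) cp≡)))
      middle-load : ∀ {i} → i < D → numActive (suc (T + i)) requested ≡ 1
      middle-load {i} i<D = trans (numActive-on (suc (T + i))) (cong length (on-middle cp cp≡ i<D))
      final-load : numActive last requested ≡ g * X
      final-load = trans (numActive-on last) (trans (cong length (on-final cp cp≡)) (trans (length-map (_/ g) (upTo (g * X))) (length-upTo (g * X))))

    paddedInstance : PaddedInstance g T core μ k X
    paddedInstance = record
      { I = padded
      ; sizes≡ = requested-sizes
      ; rest = tail
      ; intervals≡ = refl
      ; horizon≡ = trans (cong (suc T +_) sum-lengths) (sym (+-suc T (μ + k)))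
      ; maxDuration≡ = padded-maxDuration
      ; load≡ = trans padded-load (cong (λ d → Σ< T (λ t → ⌈ numActive (suc t) core /⌉ g) + (d + X)) sum-lengths)
      ; schedulable = λ pl pl≡ fits → subst (λ d → ∃[ σ ] Feasible padded σ × cost padded σ ≤ Σ< T (λ t → bins (suc t) pl) + (d + X))
          sum-lengths (schedule-padded pl pl≡ fits)
      }

  load-≤-cost : ∀ I g .{{_ : NonZero g}} → (sizes≡ : All (λ J → size J ≡ 1 /ₙ g) (intervals I)) → ∀ σ → Feasible I σ →
    Σ< (horizon I) (λ t → ⌈ numActive (suc t) (intervals I) /⌉ g) ≤ cost I σ
  load-≤-cost I g sizes≡ σ feas = subst (_ ≤_) (sym (cost-placed I σ)) (Σ<-mono (horizon I) (λ t _ → ⌈/⌉-≤ g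
    (subst (_≤ g * bins (suc t) (placed I σ)) (trans (length-on (suc t) (placed I σ)) (cong (numActive (suc t)) map-proj₁-placed))
      (length-≤-distinct (on (suc t) (placed I σ)) (λ m → Feasible⇒Fits I σ g sizes≡ feas m (suc t))))))
    where
    map-proj₁-placed : map proj₁ (placed I σ) ≡ intervals I
    map-proj₁-placed = trans (sym (map-∘ (allFin (length (intervals I))))) (trans (map-tabulate id (lookup (intervals I))) (tabulate-lookup (intervals I)))

  -- Arithmetic of the final estimate

  -- This keeps the blocks of the adversary within length `μ`. If it failed, monotonicity would
  -- bound the rounded logarithm by its own predecessor; it would be zero, and `n` would be below 1.
  2^[⌈log₂⌉∸1]≤ : ∀ n → 1 ≤ n → 2 ^ (⌈log₂ n ⌉ ∸ 1) ≤ n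
  2^[⌈log₂⌉∸1]≤ n 1≤n with 2 ^ (⌈log₂ n ⌉ ∸ 1) ≤? n
  ... | yes p = p
  ... | no ¬p = absurd ⌈log₂ n ⌉ (≰⇒> ¬p) (subst (⌈log₂ n ⌉ ≤_) (⌈log₂2^n⌉≡n (⌈log₂ n ⌉ ∸ 1)) (⌈log₂⌉-mono-≤ (<⇒≤ (≰⇒> ¬p))))
    where
    absurd : ∀ c → n < 2 ^ (c ∸ 1) → c ≤ c ∸ 1 → 2 ^ (⌈log₂ n ⌉ ∸ 1) ≤ n
    absurd zero n<1 _ = ⊥-elim (<⇒≱ n<1 1≤n)
    absurd (suc c) _ c<c = ⊥-elim (<-irrefl refl c<c)

  -- The origin of the capacity `suc g`, which approximates the square root of `(p + n) / p`. As `n`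
  -- grows, `g` advances when the next square fits. Starting at `p` makes capacity 1 fit, and the
  -- factor 4 arises because the next capacity is at most twice the present one.
  square-approximation : ∀ p n → 1 ≤ p → ∃[ g ] suc g * suc g * p ≤ p + n × p + n ≤ 4 * (suc g * suc g * p)
  square-approximation p zero 1≤p = 0 , ≤-reflexive (trans (*-identityˡ p) (sym (+-identityʳ p))) ,
    ≤-trans (≤-reflexive (trans (+-identityʳ p) (sym (*-identityˡ p)))) (m≤n*m (1 * p) 4)
  square-approximation p (suc n) 1≤p with square-approximation p n 1≤p
  ... | g , lower , upper with suc (suc g) * suc (suc g) * p ≤? p + suc n
  ...   | no ¬le = g , ≤-trans lower (+-monoʳ-≤ p (n≤1+n n)) ,
    ≤-trans (<⇒≤ (≰⇒> ¬le)) (≤-trans (*-monoˡ-≤ p (*-mono-≤ double double)) (≤-reflexive (rearrange (suc g) p)))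
    where
    double : suc (suc g) ≤ 2 * suc g
    double = s≤s (≤-trans (≤-reflexive (cong suc (sym (+-identityʳ g)))) (m≤n+m (suc (g + 0)) g))
    rearrange : ∀ h p → 2 * h * (2 * h) * p ≡ 4 * (h * h * p)
    rearrange = solve-∀
  ...   | yes le = suc g , le , (begin
      p + suc n                                                ≡⟨ +-suc p n ⟩
      suc (p + n)                                              ≤⟨ +-mono-≤ (≤-trans 1≤p (m≤n*m p (4 * (3 + 2 * g)))) upper ⟩
      4 * (3 + 2 * g) * p + 4 * (suc g * suc g * p)            ≡⟨ rearrange g p ⟩
      4 * (suc (suc g) * suc (suc g) * p)                      ∎)
    where
    open ≤-Reasoning
    rearrange : ∀ g p → 4 * (3 + 2 * g) * p + 4 * (suc g * suc g * p) ≡ 4 * (suc (suc g) * suc (suc g) * p)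
    rearrange = solve-∀

  -- After clearing denominators, the averages contribute `T` once on one side and twice on the
  -- other, so a single `T` stays beside `opt`.
  sqrt-bound : ∀ M opt l a T .{{_ : NonZero M}} .{{_ : NonZero T}} → opt * T * l ≤ M * M * (a * a) →
    (1 /ₙ M) ·√ (opt /ₙ T ℚ.* l /ₙ 1) ≤ (a /ₙ T)
  sqrt-bound M opt l a T le = /ₙ-≤ {0} {1} {a} {T} z≤n , subst₂ ℚ._≤_ (sym lhs) (sym rhs)
    (/ₙ-≤ {1 * 1 * (opt * l)} {M * M * (T * 1)} {a * a} {T * T} {{nz₃}} {{nz₄}} (begin
      1 * 1 * (opt * l) * (T * T)    ≡⟨ rearrange₁ opt l T ⟩
      opt * T * l * T                ≤⟨ *-monoˡ-≤ T le ⟩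
      M * M * (a * a) * T            ≡⟨ rearrange₂ M a T ⟩
      a * a * (M * M * (T * 1))      ∎))
    where
    open ≤-Reasoning
    rearrange₁ : ∀ o l T → 1 * 1 * (o * l) * (T * T) ≡ o * T * l * T
    rearrange₁ = solve-∀
    rearrange₂ : ∀ M a T → M * M * (a * a) * T ≡ a * a * (M * M * (T * 1))
    rearrange₂ = solve-∀
    nz₁ : NonZero (M * M)
    nz₁ = m*n≢0 M M
    nz₂ : NonZero (T * 1)
    nz₂ = m*n≢0 T 1
    nz₃ : NonZero (M * M * (T * 1))
    nz₃ = m*n≢0 (M * M) (T * 1) {{nz₁}} {{nz₂}}
    nz₄ : NonZero (T * T)
    nz₄ = m*n≢0 T T
    lhs : 1 /ₙ M ℚ.* 1 /ₙ M ℚ.* (opt /ₙ T ℚ.* l /ₙ 1) ≡ _/ₙ_ (1 * 1 * (opt * l)) (M * M * (T * 1)) {{nz₃}}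
    lhs = trans (cong₂ ℚ._*_ (/ₙ-* 1 M 1 M {{bd≢0 = nz₁}}) (/ₙ-* opt T l 1 {{bd≢0 = nz₂}}))
      (/ₙ-* (1 * 1) (M * M) (opt * l) (T * 1) {{nz₁}} {{nz₂}} {{nz₃}})
    rhs : a /ₙ T ℚ.* a /ₙ T ≡ _/ₙ_ (a * a) (T * T) {{nz₄}}
    rhs = /ₙ-* a T a T {{bd≢0 = nz₄}}

  fraction : ∀ v → 1ℚ ℚ.< v → ∃[ p ] ∃[ h ] v ≡ p /ₙ suc h × suc h < p
  fraction v@(mkℚ (pos p) h _) (ℚ.*<* lt) = p , h , sym (ℚ.↥p/↧p≡p v) , ℤ.drop‿+<+ (subst₂ ℤ._<_ (ℤ.*-identityˡ (pos (suc h))) (ℤ.*-identityʳ (pos p)) lt)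
  fraction (mkℚ (ℤ.-[1+ _ ]) h _) (ℚ.*<* ())

  -- The horizon is `q * s` and the total load `p * s`. Both `opt` and the load are at most `A`, and
  -- `l * q ≤ q + L * q ≤ 2 * p`, so already `2 * (A * A)` bounds the left side; the larger constant
  -- is shared with the main regime.
  trivial-regime : ∀ K p q s L l opt A → L * q < p → q ≤ p → l ≤ suc L → opt ≤ A → p * s ≤ A →
      opt * (q * s) * l ≤ (36 + 24 * K) * (36 + 24 * K) * (A * A)
  trivial-regime K p q s L l opt A Lq<p q≤p l≤ opt≤ ps≤ = begin
    opt * (q * s) * l              ≡⟨ rearrange₁ opt q s l ⟩
    opt * (l * q * s)              ≤⟨ *-mono-≤ opt≤ (*-monoˡ-≤ s (≤-trans (*-monoˡ-≤ q l≤) (+-mono-≤ q≤p (<⇒≤ Lq<p)))) ⟩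
    A * ((p + p) * s)              ≡⟨ rearrange₂ A p s ⟩
    2 * (A * (p * s))              ≤⟨ *-monoʳ-≤ 2 (*-monoʳ-≤ A ps≤) ⟩
    2 * (A * A)                    ≤⟨ *-monoˡ-≤ (A * A) (*-mono-≤ {2} {36 + 24 * K} {1} {36 + 24 * K} (s≤s (s≤s z≤n)) (s≤s z≤n)) ⟩
    (36 + 24 * K) * (36 + 24 * K) * (A * A) ∎
    where
    open ≤-Reasoning
    rearrange₁ : ∀ o q s l → o * (q * s) * l ≡ o * (l * q * s)
    rearrange₁ = solve-∀
    rearrange₂ : ∀ A p s → A * ((p + p) * s) ≡ 2 * (A * (p * s))
    rearrange₂ = solve-∀

  module _ (K p q g m s L l W opt A₁ A : ℕ) where

    -- 36 + 24 K = 3 (12 + 8 K), from g W ≤ 8 A₁ and g p s ≤ (4 + 8 K) A₁ together with 8 < 3².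
    main-regime : .{{_ : NonZero g}} → g * g * p ≤ L * q → L * q ≤ 4 * (g * g * p) → q ≤ p → l ≤ 2 * L →
      L * (q * m) ≤ 2 * (g * A₁) → g * W ≤ 2 * (g * (q * m)) + 4 * A₁ → p * s ≤ 2 * (p * m) + K * W →
      opt ≤ W + p * s → A₁ ≤ A →
      opt * (q * s) * l ≤ (36 + 24 * K) * (36 + 24 * K) * (A * A)
    main-regime g²p≤ ≤4g²p q≤p l≤ LT≤ gW≤ ps≤ opt≤ A₁≤ = begin
      opt * (q * s) * l                            ≤⟨ *-mono-≤ (*-monoˡ-≤ (q * s) opt≤) l≤ ⟩
      (W + p * s) * (q * s) * (2 * L)              ≡⟨ rearrange₁ (W + p * s) q s L ⟩
      2 * ((W + p * s) * s * (L * q))              ≤⟨ *-monoʳ-≤ 2 (*-monoʳ-≤ ((W + p * s) * s) ≤4g²p) ⟩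
      2 * ((W + p * s) * s * (4 * (g * g * p)))    ≡⟨ rearrange₂ W p s g ⟩
      -- One factor `g` goes to the bound on OPT and one to the total load, each being of order
      -- `A₁ / g`.
      8 * ((g * W + g * (p * s)) * (g * (p * s)))  ≤⟨ *-monoʳ-≤ 8 (*-mono-≤ (+-mono-≤ gW≤8A₁ gps≤) gps≤) ⟩
      8 * ((8 * A₁ + (4 + 8 * K) * A₁) * ((4 + 8 * K) * A₁))
        ≤⟨ *-mono-≤ {8} {9} (n≤1+n 8) (*-mono-≤ (≤-refl {8 * A₁ + (4 + 8 * K) * A₁}) (m≤n+m ((4 + 8 * K) * A₁) (8 * A₁))) ⟩
      9 * ((8 * A₁ + (4 + 8 * K) * A₁) * (8 * A₁ + (4 + 8 * K) * A₁))
        ≡⟨ rearrange₃ K A₁ ⟩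
      (36 + 24 * K) * (36 + 24 * K) * (A₁ * A₁)    ≤⟨ *-monoʳ-≤ ((36 + 24 * K) * (36 + 24 * K)) (*-mono-≤ A₁≤ A₁≤) ⟩
      (36 + 24 * K) * (36 + 24 * K) * (A * A)      ∎
      where
      open ≤-Reasoning
      rearrange₁ : ∀ x q s L → x * (q * s) * (2 * L) ≡ 2 * (x * s * (L * q))
      rearrange₁ = solve-∀
      rearrange₂ : ∀ W p s g → 2 * ((W + p * s) * s * (4 * (g * g * p))) ≡ 8 * ((g * W + g * (p * s)) * (g * (p * s)))
      rearrange₂ = solve-∀
      rearrange₃ : ∀ K a → 9 * ((8 * a + (4 + 8 * K) * a) * (8 * a + (4 + 8 * K) * a)) ≡ (36 + 24 * K) * (36 + 24 * K) * (a * a)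
      rearrange₃ = solve-∀
      -- By the choice of `g`, the load allotted to the adversary's steps inherits the bound on the
      -- levels, and one factor `g` cancels.
      gpm≤ : g * (p * m) ≤ 2 * A₁
      gpm≤ = *-cancelˡ-≤ g (begin
        g * (g * (p * m))    ≡⟨ assoc₁ g p m ⟩
        g * g * p * m        ≤⟨ *-monoˡ-≤ m g²p≤ ⟩
        L * q * m            ≡⟨ *-assoc L q m ⟩
        L * (q * m)          ≤⟨ LT≤ ⟩
        2 * (g * A₁)         ≡⟨ assoc₂ g A₁ ⟩
        g * (2 * A₁)         ∎)
        where
        assoc₁ : ∀ g p m → g * (g * (p * m)) ≡ g * g * p * m
        assoc₁ = solve-∀
        assoc₂ : ∀ g a → 2 * (g * a) ≡ g * (2 * a)
        assoc₂ = solve-∀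
      gW≤8A₁ : g * W ≤ 8 * A₁
      gW≤8A₁ = begin
        g * W                          ≤⟨ gW≤ ⟩
        2 * (g * (q * m)) + 4 * A₁     ≤⟨ +-monoˡ-≤ (4 * A₁) (*-monoʳ-≤ 2 (≤-trans (*-monoʳ-≤ g (*-monoˡ-≤ m q≤p)) gpm≤)) ⟩
        2 * (2 * A₁) + 4 * A₁          ≡⟨ collect A₁ ⟩
        8 * A₁                         ∎
        where
        collect : ∀ a → 2 * (2 * a) + 4 * a ≡ 8 * a
        collect = solve-∀
      gps≤ : g * (p * s) ≤ (4 + 8 * K) * A₁
      gps≤ = begin
        g * (p * s)                      ≤⟨ *-monoʳ-≤ g ps≤ ⟩
        g * (2 * (p * m) + K * W)        ≡⟨ distribute g (p * m) K W ⟩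
        2 * (g * (p * m)) + K * (g * W)  ≤⟨ +-mono-≤ (*-monoʳ-≤ 2 gpm≤) (*-monoʳ-≤ K gW≤8A₁) ⟩
        2 * (2 * A₁) + K * (8 * A₁)      ≡⟨ collect K A₁ ⟩
        (4 + 8 * K) * A₁                 ∎
        where
        distribute : ∀ g x K W → g * (2 * x + K * W) ≡ 2 * (g * x) + K * (g * W)
        distribute = solve-∀
        collect : ∀ K a → 2 * (2 * a) + K * (8 * a) ≡ (4 + 8 * K) * a
        collect = solve-∀

  -- The lower bound

  Witness : OnlineAlgorithm Uniform → ℚ → ℕ → ℚ → Set
  Witness A v μ c = ∃[ I ] Uniform I × averageLoad I ≡ v × maxDuration I ≡ μ ×
    (∃[ opt ] IsOPT I opt × c ·√ ((pos opt perStepOf I) ℚ.* (⌈log₂ μ ⌉ /ₙ 1)) ≤ averageCost I (schedule A I))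

  -- The target average load is p / q with p = q + e; the adversary plays c rounds of length q 2ᴸ (none when μ is too small to matter).
  module Construction (Alg : OnlineAlgorithm Uniform) (q e : ℕ) {{_ : NonZero q}} {{_ : NonZero e}}
    (μ : ℕ) (1≤μ : 1 ≤ μ) (g : ℕ) {{_ : NonZero g}} (c : ℕ) where

    p L m T : ℕ
    p = q + e
    L = ⌈log₂ μ ⌉ ∸ 1
    m = c * 2 ^ L
    T = q * c * 2 ^ L

    T≡ : T ≡ q * m
    T≡ = *-assoc q c (2 ^ L)

    -- The rule is consulted with the final average load and maximum duration before the instance
    -- exists; `placed≡` justifies this once the padding has made both true.
    ρ : List Interval → Interval → ℕ
    ρ = OnlineAlgorithm.rule Alg (knowing (p /ₙ q) μ)

    open Adversary g ρ L using (requests; played; phase; played-⊑; open-bins)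
    open Analysis g ρ L

    R : List Label
    R = phase T

    core : List Interval
    core = requests R

    -- The padding has `q * k` steps, that is `suc (μ + n)` with the final one, and is allotted load
    -- `p * k`. Load one per step leaves a surplus `e * k` to absorb the core's load `V`; hence
    -- `V / e` and at least one more, where `suc μ` also makes room for the long request. `X` is the
    -- load still missing.
    W V k n X : ℕ
    W = Σ< T (λ τ → ⌈ covering τ R /⌉ g)
    V = Σ< T (λ t → ⌈ numActive (suc t) core /⌉ g)
    k = V / e + suc μ
    n = q * k ∸ suc μ
    X = p * (m + k) ∸ (V + (μ + n))

    V≤W : V ≤ W
    V≤W = Σ<-mono T (λ t _ → ⌈/⌉-mono g (numActive-≤-covering g R t))

    μ+n : suc (μ + n) ≡ q * k
    μ+n = m+[n∸m]≡n (≤-trans (m≤n+m (suc μ) (V / e)) (m≤n*m k q))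

    V≤e*k : V ≤ e * k
    V≤e*k = begin
      V                            ≡⟨ m≡m%n+[m/n]*n V e ⟩
      V % e + V / e * e            ≤⟨ +-monoˡ-≤ (V / e * e) (<⇒≤ (m%n<n V e)) ⟩
      e + V / e * e                ≤⟨ +-monoˡ-≤ (V / e * e) (m≤n*m e (suc μ)) ⟩
      suc μ * e + V / e * e        ≡⟨ rearrange (suc μ) (V / e) e ⟩
      e * k                        ∎
      where
      open ≤-Reasoning
      rearrange : ∀ x y e → x * e + y * e ≡ e * (y + x)
      rearrange = solve-∀

    -- Strict, because `q * k` counts the final step and `μ + n` does not; so the final step
    -- receives a positive load.
    room : V + (μ + n) < p * (m + k)
    room = begin-strict
      V + (μ + n)                  <⟨ +-monoʳ-< V (n<1+n (μ + n)) ⟩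
      V + suc (μ + n)              ≡⟨ cong (V +_) μ+n ⟩
      V + q * k                    ≤⟨ +-monoˡ-≤ (q * k) V≤e*k ⟩
      e * k + q * k                ≤⟨ m≤n+m _ (p * m) ⟩
      p * m + (e * k + q * k)      ≡⟨ rearrange q e m k ⟩
      p * (m + k)                  ∎
      where
      open ≤-Reasoning
      rearrange : ∀ q e m k → (q + e) * m + (e * k + q * k) ≡ (q + e) * (m + k)
      rearrange = solve-∀

    1≤X : 1 ≤ X
    1≤X = m<n⇒0<n∸m room

    total : V + ((μ + n) + X) ≡ p * (m + k)
    total = trans (sym (+-assoc V (μ + n) X)) (m+[n∸m]≡n (<⇒≤ room))

    -- `K` bounds `p / e`, which is v / (v - 1), the load allotted per unit of surplus. With
    -- `suc μ ≤ m`, the share of the long request is at most the adversary's own allotment `p * m`.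
    volume-bound : ∀ K → suc μ ≤ m → p ≤ K * e → p * (m + k) ≤ 2 * (p * m) + K * W
    volume-bound K μ<m p≤Ke = begin
      p * (m + k)                           ≡⟨ rearrange p m (V / e) (suc μ) ⟩
      p * m + p * suc μ + p * (V / e)       ≤⟨ +-mono-≤ (+-monoʳ-≤ (p * m) (*-monoʳ-≤ p μ<m)) (*-monoˡ-≤ (V / e) p≤Ke) ⟩
      p * m + p * m + K * e * (V / e)       ≡⟨ collect (p * m) K e (V / e) ⟩
      2 * (p * m) + K * (V / e * e)         ≤⟨ +-monoʳ-≤ (2 * (p * m)) (*-monoʳ-≤ K (≤-trans (m/n*n≤m V e) V≤W)) ⟩
      2 * (p * m) + K * W                   ∎
      where
      open ≤-Reasoning
      rearrange : ∀ p m x y → p * (m + (x + y)) ≡ p * m + p * y + p * x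
      rearrange = solve-∀
      collect : ∀ x K e y → x + x + K * e * y ≡ 2 * x + K * (y * e)
      collect = solve-∀

    instanceWithCore : PaddedInstance g T core μ n X
    instanceWithCore = Padding.paddedInstance g T core
      (AllPairs.map⁺ (AllPairs.map (λ { (inj₁ s<t) → s≤s (<⇒≤ s<t) ; (inj₂ (refl , _)) → ≤-refl }) (proj₁ (phase-sorted T))))
      (All.map⁺ (All.universal (item-nonEmpty g) R))
      (phase-Within (q * c))
      (All.map⁺ (All.universal (λ _ → refl) R))
      (λ t t<T → lose (∈-map⁺ (item g) (unit-∈-phase t<T)) (start-Active g (t , 0)))
      μ 1≤μ
      (All.map⁺ (All.map (λ {x} j≤L → ≤-trans (item-duration-≤ g x) (≤-trans (^-monoʳ-≤ 2 j≤L) (2^[⌈log₂⌉∸1]≤ μ 1≤μ))) (phase-levels T)))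
      n X 1≤X

    module Performance (P : PaddedInstance g T core μ n X) where
      open PaddedInstance P

      horizon≡q* : horizon I ≡ q * (m + k)
      horizon≡q* = trans horizon≡ (trans (cong₂ _+_ T≡ μ+n) (sym (*-distribˡ-+ q m k)))

      load≡p* : Σ< (horizon I) (λ t → ⌈ numActive (suc t) (intervals I) /⌉ g) ≡ p * (m + k)
      load≡p* = trans load≡ total

      averageLoad≡ : averageLoad I ≡ p /ₙ q
      averageLoad≡ = trans (averageLoad-uniform I g sizes≡)
        (/ₙ-≡ {Σ< (horizon I) (λ t → ⌈ numActive (suc t) (intervals I) /⌉ g)} {horizon I} {p} {q} {{nonZero I}} (begin
          Σ< (horizon I) (λ t → ⌈ numActive (suc t) (intervals I) /⌉ g) * q  ≡⟨ cong (_* q) load≡p* ⟩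
          p * (m + k) * q                                                    ≡⟨ *-assoc p (m + k) q ⟩
          p * ((m + k) * q)                                                  ≡⟨ cong (p *_) (trans (*-comm (m + k) q) (sym horizon≡q*)) ⟩
          p * horizon I                                                      ∎))
        where open ≡-Reasoning

      uniform-I : Uniform I
      uniform-I = record { capacity = g ; uniform = sizes≡ }

      algCost : ℕ
      algCost = cost I (schedule Alg I)

      feasible : Feasible I (schedule Alg I)
      feasible = OnlineAlgorithm.correct Alg I uniform-I

      -- The anticipated knowledge is redeemed: the finished instance has the values given to `ρ`,
      -- so the real run begins with the simulated play.
      placed≡ : placed I (schedule Alg I) ≡ played R ++ play ρ core rest
      placed≡ = begin
        placed I (schedule Alg I)                                              ≡⟨ placed-run (OnlineAlgorithm.rule Alg) I ⟩
        play (OnlineAlgorithm.rule Alg (knowledge I)) [] (intervals I)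
          ≡⟨ cong₂ (λ K → play (OnlineAlgorithm.rule Alg K) []) (cong₂ knowing averageLoad≡ maxDuration≡) intervals≡ ⟩
        play ρ [] (core ++ rest)                                               ≡⟨ play-++ ρ [] core rest ⟩
        played R ++ play ρ core rest                                           ∎
        where open ≡-Reasoning

      fits : Fits g (played R)
      fits = Fits-++ˡ (played R) (play ρ core rest) (subst (Fits g) placed≡
        (Feasible⇒Fits I (schedule Alg I) g sizes≡ feasible))

      A₁ : ℕ
      A₁ = phaseCost (q * c) fits

      A₁≤algCost : A₁ ≤ algCost
      A₁≤algCost = begin
        Σ< T (λ t → bins (suc t) (played R))                     ≤⟨ Σ<-mono T (λ t _ → bins-mono-++ (suc t) (played R) (play ρ core rest)) ⟩
        Σ< T allBins                                             ≤⟨ m≤m+n (Σ< T allBins) _ ⟩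
        Σ< T allBins + Σ< (suc (μ + n)) (λ i → allBins (T + i))  ≡⟨ sym (Σ<-split T (suc (μ + n)) allBins) ⟩
        Σ< (T + suc (μ + n)) allBins                             ≡⟨ cong₂ (λ h pl → Σ< h (λ t → bins (suc t) pl)) (sym horizon≡) (sym placed≡) ⟩
        Σ< (horizon I) (λ t → bins (suc t) (placed I (schedule Alg I)))  ≡⟨ sym (cost-placed I (schedule Alg I)) ⟩
        algCost                                                  ∎
        where
        open ≤-Reasoning
        allBins : ℕ → ℕ
        allBins t = bins (suc t) (played R ++ play ρ core rest)

      load≤algCost : p * (m + k) ≤ algCost
      load≤algCost = subst (_≤ algCost) load≡p* (load-≤-cost I g sizes≡ (schedule Alg I) feasible)

      OPT : ∃[ opt ] IsOPT I opt
      OPT = OPT-exists I g sizes≡ (schedule Alg I) feasible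

      opt : ℕ
      opt = proj₁ OPT

      opt-≤ : ∀ σ → Feasible I σ → opt ≤ cost I σ
      opt-≤ = proj₂ (proj₂ OPT)

      opt≤algCost : opt ≤ algCost
      opt≤algCost = opt-≤ (schedule Alg I) feasible

      opt≤packing : opt ≤ W + p * (m + k)
      opt≤packing =
        let σ , feas , cost≤ = schedulable (packed g R) (sym (map-∘ R)) (packed-Fits g R (phase-Unique T))
        in ≤-trans (opt-≤ σ feas) (≤-trans cost≤ (+-mono-≤ (Σ<-mono T (λ t _ → packed-bins g R t))
          (≤-trans (m≤n+m ((μ + n) + X) V) (≤-reflexive total))))

      phase-bounds : L * (q * m) ≤ 2 * (g * A₁) × g * W ≤ 2 * (g * (q * m)) + 4 * A₁
      phase-bounds = subst (λ S → L * S ≤ 2 * (g * A₁) × g * W ≤ 2 * (g * S) + 4 * A₁) T≡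
        (phase-levels-bound (q * c) fits , phase-packing-bound (q * c) fits)

      witness : ∀ M .{{M≢0 : NonZero M}} → opt * (q * (m + k)) * ⌈log₂ μ ⌉ ≤ M * M * (algCost * algCost) → Witness Alg (p /ₙ q) μ (1 /ₙ M)
      witness M {{M≢0}} bound = I , uniform-I , averageLoad≡ , maxDuration≡ , opt , proj₂ OPT ,
        sqrt-bound M opt ⌈log₂ μ ⌉ algCost (horizon I) {{M≢0}} {{nonZero I}}
          (subst (λ h → opt * h * ⌈log₂ μ ⌉ ≤ M * M * (algCost * algCost)) (sym horizon≡q*) bound)

      ⌈log₂μ⌉≤ : ⌈log₂ μ ⌉ ≤ suc L
      ⌈log₂μ⌉≤ = m≤n+m∸n ⌈log₂ μ ⌉ 1

      witness-small-μ : ∀ K → L * q < p → Witness Alg (p /ₙ q) μ (1 /ₙ (36 + 24 * K))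
      witness-small-μ K Lq<p = witness (36 + 24 * K)
        (trivial-regime K p q (m + k) L ⌈log₂ μ ⌉ opt algCost Lq<p (m≤m+n q e) ⌈log₂μ⌉≤ opt≤algCost load≤algCost)

      witness-large-μ : ∀ K → p ≤ K * e → suc μ ≤ c → p ≤ L * q → g * g * p ≤ L * q → L * q ≤ 4 * (g * g * p) →
        Witness Alg (p /ₙ q) μ (1 /ₙ (36 + 24 * K))
      witness-large-μ K p≤Ke μ<c p≤Lq lower upper = witness (36 + 24 * K)
        (main-regime K p q g m (m + k) L ⌈log₂ μ ⌉ W opt A₁ algCost lower upper (m≤m+n q e)
          (≤-trans ⌈log₂μ⌉≤ (≤-trans (+-monoˡ-≤ L 1≤L) (≤-reflexive (cong (L +_) (sym (+-identityʳ L))))))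
          (proj₁ phase-bounds) (proj₂ phase-bounds)
          (volume-bound K (≤-trans μ<c (m≤m*n c (2 ^ L) {{m^n≢0 2 L}})) p≤Ke) opt≤packing A₁≤algCost)
        where
        -- It turns `suc L` into `2 * L`, and holds because `p` is positive and at most `L * q`.
        1≤L : 1 ≤ L
        1≤L = n≢0⇒n>0 λ L≡0 → <⇒≱ (≤-trans (ℕ.>-nonZero⁻¹ q) (m≤m+n q e)) (≤-trans p≤Lq (≤-reflexive (cong (_* q) L≡0)))

  witness-exists : ∀ (Alg : OnlineAlgorithm Uniform) K q e {{_ : NonZero q}} {{_ : NonZero e}} → q + e ≤ K * e →
    ∀ μ → 1 ≤ μ → Witness Alg ((q + e) /ₙ q) μ (1 /ₙ (36 + 24 * K))
  witness-exists Alg K q e p≤Ke μ 1≤μ = byCases (q + e ≤? N)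
    where
    N : ℕ
    N = (⌈log₂ μ ⌉ ∸ 1) * q
    Goal : Set
    Goal = Witness Alg ((q + e) /ₙ q) μ (1 /ₙ (36 + 24 * K))
    large : q + e ≤ N → (∃[ h ] suc h * suc h * (q + e) ≤ N × N ≤ 4 * (suc h * suc h * (q + e))) → Goal
    large p≤N (h , lower , upper) =
      -- With `suc μ` rounds `m` exceeds `μ`, so the long padding request adds only a constant
      -- factor to the load.
      let open Construction Alg q e μ 1≤μ (suc h) (suc μ)
      in Performance.witness-large-μ instanceWithCore K p≤Ke ≤-refl p≤N lower upper
    byCases : Dec (q + e ≤ N) → Goal
    byCases (no p≰N) =
      -- No rounds and capacity 1: the instance consists of padding alone.
      let open Construction Alg q e μ 1≤μ 1 0
      in Performance.witness-small-μ instanceWithCore K (≰⇒> p≰N)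
    byCases (yes p≤N) = large p≤N (subst (λ n → ∃[ h ] suc h * suc h * (q + e) ≤ n × n ≤ 4 * (suc h * suc h * (q + e)))
      (m+[n∸m]≡n p≤N) (square-approximation (q + e) (N ∸ (q + e)) (≤-trans (ℕ.>-nonZero⁻¹ q) (m≤m+n q e))))

  lower-bound : ∀ v₀ → 1ℚ ℚ.< v₀ → ∃[ c ] 0ℚ ℚ.< c ×
    (∀ (A : OnlineAlgorithm Uniform) v μ → v₀ ℚ.≤ v → 1 ≤ μ → Witness A v μ c)
  lower-bound v₀ 1<v₀ = fromFraction (fraction v₀ 1<v₀)
    where
    module _ (p₀ h₀ : ℕ) (v₀≡ : v₀ ≡ p₀ /ₙ suc h₀) (q₀<p₀ : suc h₀ < p₀) where
      constant : ℚ
      constant = 1 /ₙ (36 + 24 * p₀)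

      atFraction : ∀ A v μ → v₀ ℚ.≤ v → 1 ≤ μ → (∃[ p ] ∃[ h ] v ≡ p /ₙ suc h × suc h < p) → Witness A v μ constant
      atFraction A v μ v₀≤v 1≤μ (p , h , v≡ , q<p) = subst (λ x → Witness A x μ constant) (trans (cong (_/ₙ q) p≡) (sym v≡))
        (witness-exists A p₀ q e {{_}} {{ℕ.>-nonZero (m<n⇒0<n∸m q<p)}} (subst (_≤ p₀ * e) (sym p≡) p≤p₀e) μ 1≤μ)
        where
        q q₀ e : ℕ
        q = suc h
        q₀ = suc h₀
        e = p ∸ q
        p≡ : q + e ≡ p
        p≡ = m+[n∸m]≡n (<⇒≤ q<p)
        -- Since v / (v - 1) decreases in v, `p / e` is at most p₀ / (p₀ - q₀), whose denominator is
        -- at least 1. Adding `p₀ * q` to both sides avoids the subtraction.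
        p≤p₀e : p ≤ p₀ * e
        p≤p₀e = +-cancelˡ-≤ (p₀ * q) p (p₀ * e) (begin
          p₀ * q + p      ≤⟨ +-monoˡ-≤ p (/ₙ-≤⁻¹ {p₀} {q₀} {p} {q} (subst₂ ℚ._≤_ v₀≡ v≡ v₀≤v)) ⟩
          p * q₀ + p      ≡⟨ trans (+-comm (p * q₀) p) (sym (*-suc p q₀)) ⟩
          p * suc q₀      ≤⟨ *-monoʳ-≤ p q₀<p₀ ⟩
          p * p₀          ≡⟨ *-comm p p₀ ⟩
          p₀ * p          ≡⟨ cong (p₀ *_) (sym p≡) ⟩
          p₀ * (q + e)    ≡⟨ *-distribˡ-+ p₀ q e ⟩
          p₀ * q + p₀ * e ∎)
          where open ≤-Reasoning

    fromFraction : (∃[ p ] ∃[ h ] v₀ ≡ p /ₙ suc h × suc h < p) → ∃[ c ] 0ℚ ℚ.< c ×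
      (∀ (A : OnlineAlgorithm Uniform) v μ → v₀ ℚ.≤ v → 1 ≤ μ → Witness A v μ c)
    fromFraction (p₀ , h₀ , v₀≡ , q₀<p₀) = 1 /ₙ (36 + 24 * p₀) , ℚ.positive⁻¹ (1 /ₙ (36 + 24 * p₀)) {{ℚ.normalize-pos 1 (36 + 24 * p₀)}} ,
      λ A v μ v₀≤v 1≤μ → atFraction p₀ h₀ v₀≡ q₀<p₀ A v μ v₀≤v 1≤μ (fraction v (ℚ.<-≤-trans 1<v₀ v₀≤v))

open import Defs
open import Data.Integer using (+_)
open import Data.Nat using (ℕ) renaming (_≤_ to _≤ℕ_)
open import Data.Nat.Logarithm using (⌈log₂_⌉)
open import Data.Product using (_×_; ∃-syntax)
open import Data.Rational using (ℚ; 0ℚ; 1ℚ; _<_; _≤_; _*_; _/_)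
open import Relation.Binary.PropositionalEquality using (_≡_)

theorem1p3 : ∀ (v₀ : ℚ) → 1ℚ < v₀ →
    ∃[ c ] 0ℚ < c ×
    (∀ (A : OnlineAlgorithm Uniform) (v : ℚ) (μ : ℕ) → v₀ ≤ v → 1 ≤ℕ μ →
    ∃[ I ] Uniform I × averageLoad I ≡ v × maxDuration I ≡ μ ×
    (∃[ opt ] IsOPT I opt ×
    c ·√ (((+ opt) perStepOf I) * ((+ ⌈log₂ μ ⌉) / 1)) ≤ averageCost I (schedule A I)))
theorem1p3 = LowerBound.lower-bound
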